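{- Let $\mathcal A=(V,\mathcal R)$ be a symmetric association scheme with $d$ classes, with adjacency matrices $A_0,\dots,A_d$, maximal common eigenspaces $W_0,\dots,W_d$ of $\mathbf C^V$, primitive idempotents $E_0,\dots,E_d$ ($E_j$ being the orthogonal projection onto $W_j$), and eigenvalues $P_{ji}$ ($P_{ji}$ being the eigenvalue of $A_i$ on $W_j$). Let $\pi=\{C_1,\dots,C_t\}$ be an equitable partition of $\mathcal A$ with characteristic matrix $H$, quotient matrices $N_0,\dots,N_d$ (so that $A_iH=HN_i$), and let $F$ be the matrix of the orthogonal projection of $\mathbf C^V$ onto the column space of $H$. Then for every $0\le j\le d$, $$\langle F,E_j\rangle=m_j,$$ where $m_j=\dim(W_jH)$ is, for every $0\le i\le d$, the multiplicity of $P_{ji}$ as an eigenvalue of $N_i$ on the space $W_jH$ (that is, $W_jH$ has dimension $m_j$ and $uN_i=P_{ji}u$ for all row vectors $u\in W_jH$ and all $0\le i\le d$).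
   Context: Association scheme: $V$ is a finite set of size $v$, $\mathcal R=\{R_0,\dots,R_d\}$ is a set of non-empty subsets of $V\times V$, and $A_i\in\mathbf C^{V\times V}$ is the $0/1$ adjacency matrix of $(V,R_i)$. The pair $\mathcal A=(V,\mathcal R)$ is an association scheme with $d$ classes if: (1) $A_0=I$; (2) $\sum_{i=0}^d A_i=J$ (the all-ones matrix); (3) $A_i^{T}\in\{A_0,\dots,A_d\}$ for every $i$; (4) $A_iA_j$ is a linear combination of $A_0,\dots,A_d$ for all $i,j$. It is symmetric if all $A_i$ are symmetric matrices. The Bose–Mesner algebra $\mathbf C[\mathcal A]$ is the matrix algebra generated by $A_0,\dots,A_d$; it has basis $A_0,\dots,A_d$ and is commutative in the symmetric case. Eigenspaces: for symmetric $\mathcal A$, $\mathbf C^V=W_0\oplus W_1\oplus\dots\oplus W_d$ is the orthogonal direct sum of the $d+1$ maximal common eigenspaces of $A_0,\dots,A_d$. $E_j$ is the orthogonal projection onto $W_j$; the $E_j$ form a second basis of $\mathbf C[\mathcal A]$. The numbers $P_{ji}$ are defined by $A_i=\sum_{j=0}^d P_{ji}E_j$. Inner product: $\langle M,N\rangle=\mathrm{tr}(M^{*}N)$ for $M,N\in\mathbf C^{V\times V}$. Partitions: let $\pi$ be a partition of $V$ into $t$ (non-empty) cells $C_1,\dots,C_t$. Its characteristic matrix $H$ is the $v\times t$ matrix whose columns are the characteristic vectors of the cells. $\pi$ is an equitable partition of $\mathcal A$ if the column space of $H$ is $\mathbf C[\mathcal A]$-invariant, i.e. for every $A\in\mathbf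 C[\mathcal A]$ there is a $t\times t$ matrix $B$ (the quotient matrix of $A$) with $AH=HB$. Equivalently, for all $0\le i\le d$, $1\le j,k\le t$ and every $x\in C_k$, the number of $y\in C_j$ with $(x,y)\in R_i$ is a constant $n_{ij}^k$ independent of the choice of $x\in C_k$; the quotient matrix of $A_i$ is $N_i$ with $(N_i)_{k,j}=n_{ij}^k$. Projection matrix: with $D=H^{T}H$ (the diagonal matrix with $D_{i,i}=|C_i|$), the orthogonal projection onto the column space of $H$ is $F=HD^{ -1}H^{T}$; explicitly $F_{x,y}=1/|C_k|$ if $x,y$ lie in the same cell $C_k$, and $F_{x,y}=0$ otherwise. The space $W_jH$: viewing the elements of $W_j$ as row vectors, $W_jH=\{wH : w\in W_j\}\subseteq\mathbf C^{t}$ (row vectors). -}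

module Defs where

open import Level using (0ℓ)
open import Function.Base using (_∘_)
open import Data.Bool.Base using (Bool; true; if_then_else_)
open import Data.Nat.Base as ℕ using (ℕ; zero; suc)
import Data.Nat.Properties as ℕ
open import Data.Fin.Base using (Fin; zero)
import Data.Fin.Properties as Fin
open import Data.Product.Base using (∃; ∃-syntax; _×_; _,_; proj₁; proj₂)
open import Data.Sum.Base as Sum using (_⊎_; inj₁; inj₂)
open import Data.Rational.Base as ℚ using (ℚ; 0ℚ; 1ℚ; ½; ∣_∣)
import Data.Rational.Properties as ℚ
open import Data.Vec.Functional using (Vector)
open import Algebra.Core using (Op₁)
open import Algebra.Bundles using (CommutativeRing)
open import Algebra.Apartness
  using (HeytingField; HeytingCommutativeRing; IsHeytingField)
open import Relation.Nullary using (¬_; yes; no; does; contradiction)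
open import Relation.Nullary.Decidable using (dec⇒maybe)
open import Tactic.RingSolver using (solve-∀)
open import Tactic.RingSolver.Core.AlmostCommutativeRing
  using (AlmostCommutativeRing; fromCommutativeRing)
open import Relation.Unary using (Pred; _∈_; _⊆_; _≐_)
open import Relation.Binary.PropositionalEquality
  using (_≡_; _≢_; refl; sym; trans; cong; cong₂; subst)

private
  ℚ-ring : AlmostCommutativeRing 0ℓ 0ℓ
  ℚ-ring = fromCommutativeRing ℚ.+-*-commutativeRing (λ p → dec⇒maybe (0ℚ ℚ.≟ p))

  module Id where
    open import Data.Rational.Base using (_+_; _-_; _*_; -_)

    cancel : ∀ p q → (p - q) + q ≡ p
    cancel = solve-∀ ℚ-ring

    *-rotate : ∀ x y z → x * (y * z) ≡ (y * x) * z
    *-rotate = solve-∀ ℚ-ring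

    neg*neg : ∀ p → - p * - p ≡ p * p
    neg*neg = solve-∀ ℚ-ring

    -‿+ : ∀ a b c d → (a - b) + (c - d) ≡ (a + c) - (b + d)
    -‿+ = solve-∀ ℚ-ring

    neg-- : ∀ a b → - (a - b) ≡ - a - - b
    neg-- = solve-∀ ℚ-ring

    -‿* : ∀ a b c d → a * (c - d) + d * (a - b) ≡ a * c - b * d
    -‿* = solve-∀ ℚ-ring

    -‿inv : ∀ a b i j → (i * j) * - (a - b) ≡ i * (j * b) - (i * a) * j
    -‿inv = solve-∀ ℚ-ring

    neg-swap : ∀ a b → - (a - b) ≡ b - a
    neg-swap = solve-∀ ℚ-ring

    telescope : ∀ a b c → (a - b) + (b - c) ≡ a - c
    telescope = solve-∀ ℚ-ring

    comm-re : ∀ a b c d → a * c - b * d ≡ c * a - d * b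
    comm-re = solve-∀ ℚ-ring

    comm-im : ∀ a b c d → a * d + b * c ≡ c * b + d * a
    comm-im = solve-∀ ℚ-ring

    assoc-re : ∀ a b c d e f →
      (a * c - b * d) * e - (a * d + b * c) * f ≡ a * (c * e - d * f) - b * (c * f + d * e)
    assoc-re = solve-∀ ℚ-ring

    assoc-im : ∀ a b c d e f →
      (a * c - b * d) * f + (a * d + b * c) * e ≡ a * (c * f + d * e) + b * (c * e - d * f)
    assoc-im = solve-∀ ℚ-ring

    unit-re : ∀ a b → 1ℚ * a - 0ℚ * b ≡ a
    unit-re = solve-∀ ℚ-ring

    unit-im : ∀ a b → 1ℚ * b + 0ℚ * a ≡ b
    unit-im = solve-∀ ℚ-ring

    distrib-re : ∀ a b c d e f → a * (c + e) - b * (d + f) ≡ (a * c - b * d) + (a * e - b * f)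
    distrib-re = solve-∀ ℚ-ring

    distrib-im : ∀ a b c d e f → a * (d + f) + b * (c + e) ≡ (a * d + b * c) + (a * f + b * e)
    distrib-im = solve-∀ ℚ-ring

    difference : ∀ c a d b → (c * a - d * b) - 0ℚ ≡ c * a + - d * b
    difference = solve-∀ ℚ-ring

    norm-re : ∀ a b r → a * (a * r) - b * - (b * r) ≡ r * (a * a + b * b)
    norm-re = solve-∀ ℚ-ring

    norm-im : ∀ a b r → a * - (b * r) + b * (a * r) ≡ 0ℚ
    norm-im = solve-∀ ℚ-ring

  *-pos : ∀ {p q} → 0ℚ ℚ.< p → 0ℚ ℚ.< q → 0ℚ ℚ.< p ℚ.* q
  *-pos {p} {q} 0<p 0<q =
    subst (ℚ._< p ℚ.* q) (ℚ.*-zeroʳ p)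
      (ℚ.*-monoʳ-<-pos p {{ℚ.positive 0<p}} 0<q)

  abstract
    half : ℚ → ℚ
    half ε = ½ ℚ.* ε

    half+half : ∀ ε → half ε ℚ.+ half ε ≡ ε
    half+half ε = trans (sym (ℚ.*-distribʳ-+ ε ½ ½)) (ℚ.*-identityˡ ε)

    half-pos : ∀ {ε} → 0ℚ ℚ.< ε → 0ℚ ℚ.< half ε
    half-pos = *-pos (ℚ.positive⁻¹ ½)

    half-< : ∀ {ε} → 0ℚ ℚ.< ε → half ε ℚ.< ε
    half-< {ε} 0<ε =
      subst (ℚ._< ε) (ℚ.+-identityʳ (half ε))
        (subst (half ε ℚ.+ 0ℚ ℚ.<_) (half+half ε)
          (ℚ.+-monoʳ-< (half ε) (half-pos 0<ε)))

  *-mono-≤ : ∀ {p q r s} → 0ℚ ℚ.≤ q → 0ℚ ℚ.≤ r →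
             p ℚ.≤ q → r ℚ.≤ s → p ℚ.* r ℚ.≤ q ℚ.* s
  *-mono-≤ {q = q} {r} 0≤q 0≤r p≤q r≤s = ℚ.≤-trans
    (ℚ.*-monoʳ-≤-nonNeg r {{ℚ.nonNegative 0≤r}} p≤q)
    (ℚ.*-monoˡ-≤-nonNeg q {{ℚ.nonNegative 0≤q}} r≤s)

  ∣-∣-split : ∀ p q → ∣ p ∣ ℚ.≤ ∣ p ℚ.- q ∣ ℚ.+ ∣ q ∣
  ∣-∣-split p q = subst (λ r → ∣ r ∣ ℚ.≤ ∣ p ℚ.- q ∣ ℚ.+ ∣ q ∣)
    (Id.cancel p q)
    (ℚ.∣p+q∣≤∣p∣+∣q∣ (p ℚ.- q) q)

  pos⇒≢0 : ∀ {p} → 0ℚ ℚ.< p → p ≢ 0ℚ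
  pos⇒≢0 0<p refl = ℚ.<-irrefl refl 0<p

  ∣-∣-pos⇒≢0 : ∀ {ε p} → 0ℚ ℚ.< ε → ε ℚ.≤ ∣ p ∣ → p ≢ 0ℚ
  ∣-∣-pos⇒≢0 0<ε ε≤∣p∣ refl = ℚ.<-irrefl refl (ℚ.<-≤-trans 0<ε ε≤∣p∣)

  abstract
    inv : ℚ → ℚ
    inv p with p ℚ.≟ 0ℚ
    ... | yes _   = 0ℚ
    ... | no  p≢0 = ℚ.1/_ p {{ℚ.≢-nonZero p≢0}}

    inv-inverse : ∀ p → p ≢ 0ℚ → inv p ℚ.* p ≡ 1ℚ
    inv-inverse p p≢0 with p ℚ.≟ 0ℚ
    ... | yes p≡0 = contradiction p≡0 p≢0
    ... | no  p≢0 = ℚ.*-inverseˡ p {{ℚ.≢-nonZero p≢0}}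

    inv-pos : ∀ {p} → 0ℚ ℚ.< p → 0ℚ ℚ.< inv p
    inv-pos {p} 0<p with p ℚ.≟ 0ℚ
    ... | yes refl = contradiction 0<p (ℚ.<-irrefl refl)
    ... | no  p≢0  = ℚ.positive⁻¹ _ {{ℚ.1/pos⇒pos p {{ℚ.positive 0<p}}}}

    inv-bound : ∀ {ε p} → 0ℚ ℚ.< ε → ε ℚ.≤ ∣ p ∣ → ∣ inv p ∣ ℚ.≤ inv ε
    inv-bound {ε} {p} 0<ε ε≤∣p∣ =
      ℚ.*-cancelʳ-≤-pos ε {{ℚ.positive 0<ε}}
        (subst (∣ inv p ∣ ℚ.* ε ℚ.≤_) (sym (inv-inverse ε (pos⇒≢0 0<ε)))
          (subst (∣ inv p ∣ ℚ.* ε ℚ.≤_)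
            (trans (sym (ℚ.∣p*q∣≡∣p∣*∣q∣ (inv p) p))
              (cong ∣_∣ (inv-inverse p (∣-∣-pos⇒≢0 0<ε ε≤∣p∣))))
            (ℚ.*-monoˡ-≤-nonNeg ∣ inv p ∣ {{ℚ.∣-∣-nonNeg (inv p)}} ε≤∣p∣)))

  *-inv-cancel : ∀ {p} → 0ℚ ℚ.< p → ∀ q → p ℚ.* (inv p ℚ.* q) ≡ q
  *-inv-cancel {p} 0<p q = trans
    (Id.*-rotate p (inv p) q)
    (trans (cong (ℚ._* q) (inv-inverse p (pos⇒≢0 0<p))) (ℚ.*-identityˡ q))

  square-nonNeg : ∀ p → 0ℚ ℚ.≤ p ℚ.* p
  square-nonNeg p with ℚ.∣p∣≡p∨∣p∣≡-p p
  ... | inj₁ eq = subst (0ℚ ℚ.≤_) (cong (λ r → r ℚ.* r) eq)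
                    (*-mono-≤ (ℚ.0≤∣p∣ p) ℚ.≤-refl (ℚ.0≤∣p∣ p) (ℚ.0≤∣p∣ p))
  ... | inj₂ eq = subst (0ℚ ℚ.≤_)
                    (trans (cong (λ r → r ℚ.* r) eq)
                      (Id.neg*neg p))
                    (*-mono-≤ (ℚ.0≤∣p∣ p) ℚ.≤-refl (ℚ.0≤∣p∣ p) (ℚ.0≤∣p∣ p))

module Tails {I : Set} (_≽_ : I → ℕ → Set)
             (weaken : ∀ {i M N} → M ℕ.≤ N → i ≽ N → i ≽ M) where

  Eventually : (I → Set) → Set
  Eventually Q = ∃[ N ] ∀ {i} → i ≽ N → Q i

  record Null (f : I → ℚ) : Set where
    constructor mkNull
    field small : ∀ ε → 0ℚ ℚ.< ε → Eventually (λ i → ∣ f i ∣ ℚ.< ε)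
  open Null public

  record Bounded (f : I → ℚ) : Set where
    constructor mkBounded
    field
      bound     : ℚ
      bound-pos : 0ℚ ℚ.< bound
      ≤bound    : Eventually (λ i → ∣ f i ∣ ℚ.≤ bound)

  both : ∀ {P Q} → Eventually P → Eventually Q → Eventually (λ i → P i × Q i)
  both (M , p) (N , q) = M ℕ.⊔ N , λ i≽ →
    p (weaken (ℕ.m≤m⊔n M N) i≽) , q (weaken (ℕ.m≤n⊔m M N) i≽)

  map : ∀ {P Q : I → Set} → (∀ {i} → P i → Q i) → Eventually P → Eventually Q
  map f (N , p) = N , λ i≽ → f (p i≽)

  always : ∀ {P : I → Set} → (∀ i → P i) → Eventually P
  always p = 0 , λ {i} _ → p i

  null-resp : ∀ {f g} → Eventually (λ i → f i ≡ g i) → Null f → Null g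
  small (null-resp f≡g nf) ε 0<ε =
    map (λ (eq , lt) → subst (λ r → ∣ r ∣ ℚ.< ε) eq lt) (both f≡g (small nf ε 0<ε))

  null-0 : Null (λ _ → 0ℚ)
  small null-0 ε 0<ε = always (λ _ → 0<ε)

  null-neg : ∀ {f} → Null f → Null (λ i → ℚ.- f i)
  small (null-neg {f} nf) ε 0<ε =
    map (λ {i} → subst (ℚ._< ε) (sym (ℚ.∣-p∣≡∣p∣ (f i)))) (small nf ε 0<ε)

  null-+ : ∀ {f g} → Null f → Null g → Null (λ i → f i ℚ.+ g i)
  small (null-+ {f} {g} nf ng) ε 0<ε =
    map (λ {i} (p , q) → ℚ.≤-<-trans (ℚ.∣p+q∣≤∣p∣+∣q∣ (f i) (g i))
          (subst (∣ f i ∣ ℚ.+ ∣ g i ∣ ℚ.<_) (half+half ε) (ℚ.+-mono-< p q)))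
        (both (small nf (half ε) (half-pos 0<ε)) (small ng (half ε) (half-pos 0<ε)))

  null-* : ∀ {b f} → Bounded b → Null f → Null (λ i → b i ℚ.* f i)
  small (null-* {b} {f} (mkBounded B 0<B b≤B) nf) ε 0<ε =
    map (λ {i} (p , q) → subst (ℚ._< ε) (sym (ℚ.∣p*q∣≡∣p∣*∣q∣ (b i) (f i)))
          (ℚ.≤-<-trans
            (ℚ.*-monoʳ-≤-nonNeg ∣ f i ∣ {{ℚ.∣-∣-nonNeg (f i)}} p)
            (subst (B ℚ.* ∣ f i ∣ ℚ.<_) (*-inv-cancel 0<B ε)
              (ℚ.*-monoʳ-<-pos B {{ℚ.positive 0<B}} q))))
        (both b≤B (small nf (inv B ℚ.* ε) (*-pos (inv-pos 0<B) 0<ε)))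

  bounded-* : ∀ {f g} → Bounded f → Bounded g → Bounded (λ i → f i ℚ.* g i)
  bounded-* {f} {g} (mkBounded B 0<B f≤B) (mkBounded C 0<C g≤C) =
    mkBounded (B ℚ.* C) (*-pos 0<B 0<C)
    (map (λ {i} (p , q) →
          subst (ℚ._≤ B ℚ.* C) (sym (ℚ.∣p*q∣≡∣p∣*∣q∣ (f i) (g i)))
            (*-mono-≤ (ℚ.<⇒≤ 0<B) (ℚ.0≤∣p∣ (g i)) p q))
        (both f≤B g≤C))

module Seq = Tails {ℕ} ℕ._≥_ (λ M≤N N≤i → ℕ.≤-trans M≤N N≤i)
module Pairs = Tails {ℕ × ℕ} (λ (m , n) N → m ℕ.≥ N × n ℕ.≥ N)
             (λ M≤N (p , q) → ℕ.≤-trans M≤N p , ℕ.≤-trans M≤N q)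

Cauchy : (ℕ → ℚ) → Set
Cauchy x = Pairs.Null (λ (m , n) → x m ℚ.- x n)

-- Bounded away from zero; the positive form of "not null".
record Away (x : ℕ → ℚ) : Set where
  constructor mkAway
  field
    gap     : ℚ
    gap-pos : 0ℚ ℚ.< gap
    gap≤    : Seq.Eventually (λ n → gap ℚ.≤ ∣ x n ∣)
open Away public

-- Cauchy sequences of rationals; equality _≈ᵣ_ is up to null sequences.
record ℝ : Set where
  constructor mkℝ
  field
    seq    : ℕ → ℚ
    cauchy : Cauchy seq
open ℝ public

infix 4 _≈ᵣ_ _#ᵣ_

-- Equality and apartness are records so that x and y can be inferred.
record _≈ᵣ_ (x y : ℝ) : Set where
  constructor mk≈
  field null : Seq.Null (λ n → seq x n ℚ.- seq y n)
open _≈ᵣ_ public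

record _#ᵣ_ (x y : ℝ) : Set where
  constructor mk#
  field away : Away (λ n → seq x n ℚ.- seq y n)
open _#ᵣ_ public

cauchy⇒bounded : ∀ x → Cauchy x → Seq.Bounded x
cauchy⇒bounded x cx with Pairs.small cx 1ℚ (ℚ.positive⁻¹ 1ℚ)
... | N , close = Seq.mkBounded (1ℚ ℚ.+ ∣ x N ∣)
    (ℚ.<-≤-trans (ℚ.positive⁻¹ 1ℚ)
      (subst (ℚ._≤ 1ℚ ℚ.+ ∣ x N ∣) (ℚ.+-identityʳ 1ℚ)
        (ℚ.+-monoʳ-≤ 1ℚ (ℚ.0≤∣p∣ (x N)))))
    (N , λ {n} n≥N → ℚ.≤-trans (∣-∣-split (x n) (x N))
      (ℚ.+-monoˡ-≤ ∣ x N ∣ (ℚ.<⇒≤ (close (n≥N , ℕ.≤-refl)))))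

bounded-fst : ∀ x → Seq.Bounded x → Pairs.Bounded (x ∘ proj₁)
bounded-fst _ (Seq.mkBounded B 0<B (N , p)) = Pairs.mkBounded B 0<B (N , λ (m≥N , _) → p m≥N)

bounded-snd : ∀ x → Seq.Bounded x → Pairs.Bounded (x ∘ proj₂)
bounded-snd _ (Seq.mkBounded B 0<B (N , p)) = Pairs.mkBounded B 0<B (N , λ (_ , n≥N) → p n≥N)

cauchy-const : ∀ q → Cauchy (λ _ → q)
cauchy-const q = Pairs.null-resp (Pairs.always (λ _ → sym (ℚ.+-inverseʳ q))) Pairs.null-0

cauchy-+ : ∀ x y → Cauchy x → Cauchy y → Cauchy (λ n → x n ℚ.+ y n)
cauchy-+ x y cx cy = Pairs.null-resp
  (Pairs.always λ (m , n) → Id.-‿+ (x m) (x n) (y m) (y n))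
  (Pairs.null-+ cx cy)

cauchy-neg : ∀ x → Cauchy x → Cauchy (λ n → ℚ.- x n)
cauchy-neg x cx = Pairs.null-resp
  (Pairs.always λ (m , n) → Id.neg-- (x m) (x n))
  (Pairs.null-neg cx)

cauchy-* : ∀ x y → Cauchy x → Cauchy y → Cauchy (λ n → x n ℚ.* y n)
cauchy-* x y cx cy = Pairs.null-resp
  (Pairs.always λ (m , n) → Id.-‿* (x m) (x n) (y m) (y n))
  (Pairs.null-+ (Pairs.null-* (bounded-fst x (cauchy⇒bounded x cx)) cy)
            (Pairs.null-* (bounded-snd y (cauchy⇒bounded y cy)) cx))

cauchy-inv : ∀ x → Away x → Cauchy x → Cauchy (inv ∘ x)
cauchy-inv x (mkAway ε 0<ε (N , ε≤)) cx = Pairs.null-resp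
  (N , λ {(m , n)} (m≥N , n≥N) →
    step (x m) (x n) (∣-∣-pos⇒≢0 0<ε (ε≤ m≥N)) (∣-∣-pos⇒≢0 0<ε (ε≤ n≥N)))
  (Pairs.null-* (Pairs.bounded-* (bounded-fst (inv ∘ x) bd) (bounded-snd (inv ∘ x) bd)) (Pairs.null-neg cx))
  where
  bd : Seq.Bounded (inv ∘ x)
  bd = Seq.mkBounded (inv ε) (inv-pos 0<ε) (N , λ n≥N → inv-bound 0<ε (ε≤ n≥N))
  step : ∀ a b → a ≢ 0ℚ → b ≢ 0ℚ →
         (inv a ℚ.* inv b) ℚ.* ℚ.- (a ℚ.- b) ≡ inv a ℚ.- inv b
  step a b a≢0 b≢0 = trans
    (Id.-‿inv a b (inv a) (inv b))
    (cong₂ ℚ._-_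
      (trans (cong (inv a ℚ.*_) (inv-inverse b b≢0)) (ℚ.*-identityʳ (inv a)))
      (trans (cong (ℚ._* inv b) (inv-inverse a a≢0)) (ℚ.*-identityˡ (inv b))))

small-or-away : ∀ x → Cauchy x → ∀ ε → 0ℚ ℚ.< ε →
                Seq.Eventually (λ n → ∣ x n ∣ ℚ.< ε) ⊎ Away x
small-or-away x cx ε 0<ε with Pairs.small cx δ 0<δ
  where
  δ   = half (half ε)
  0<δ = half-pos (half-pos 0<ε)
... | N , close with ∣ x N ∣ ℚ.<? half ε
... | yes lt = inj₁ (N , λ {n} n≥N → ℚ.≤-<-trans (∣-∣-split (x n) (x N))
        (subst (∣ x n ℚ.- x N ∣ ℚ.+ ∣ x N ∣ ℚ.<_) (half+half ε)
          (ℚ.+-mono-< (ℚ.<-trans (close (n≥N , ℕ.≤-refl)) (half-< (half-pos 0<ε))) lt)))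
... | no ¬lt = inj₂ (mkAway (half (half ε)) (half-pos (half-pos 0<ε)) (N , λ {n} n≥N →
        ℚ.≮⇒≥ λ lt → ¬lt (ℚ.≤-<-trans (∣-∣-split (x N) (x n))
          (subst (∣ x N ℚ.- x n ∣ ℚ.+ ∣ x n ∣ ℚ.<_) (half+half (half ε))
            (ℚ.+-mono-< (close (ℕ.≤-refl , n≥N)) lt)))))

away-resp : ∀ {x y : ℕ → ℚ} → (∀ n → x n ≡ y n) → Away x → Away y
away-resp x≡y (mkAway ε 0<ε ev) =
  mkAway ε 0<ε (Seq.map (λ {n} → subst (λ r → ε ℚ.≤ ∣ r ∣) (x≡y n)) ev)

null⇒¬away : ∀ {x} → Seq.Null x → ¬ Away x
null⇒¬away nx (mkAway ε 0<ε ev) with Seq.both (Seq.small nx ε 0<ε) ev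
... | N , p = ℚ.<-irrefl refl (ℚ.≤-<-trans (proj₂ (p ℕ.≤-refl)) (proj₁ (p ℕ.≤-refl)))

¬away⇒null : ∀ x → Cauchy x → ¬ Away x → Seq.Null x
Seq.small (¬away⇒null x cx ¬a) ε 0<ε =
  Sum.[ (λ s → s) , (λ a → contradiction a ¬a) ]′ (small-or-away x cx ε 0<ε)

away-+ : ∀ x y → Cauchy x → Cauchy y →
         Away (λ n → x n ℚ.+ y n) → Away x ⊎ Away y
away-+ x y cx cy (mkAway ε 0<ε ev) =
  Sum.[ (λ s → Sum.[ (λ t → contradiction (Seq.both ev (Seq.both s t)) absurd) , inj₂ ]′
                 (small-or-away y cy (half ε) (half-pos 0<ε)))
      , inj₁ ]′
    (small-or-away x cx (half ε) (half-pos 0<ε))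
  where
  absurd : ¬ Seq.Eventually (λ n → ε ℚ.≤ ∣ x n ℚ.+ y n ∣ ×
                                 ∣ x n ∣ ℚ.< half ε × ∣ y n ∣ ℚ.< half ε)
  absurd (N , p) = let big , s , t = p ℕ.≤-refl in
    ℚ.<-irrefl refl (ℚ.≤-<-trans big (ℚ.≤-<-trans (ℚ.∣p+q∣≤∣p∣+∣q∣ (x N) (y N))
      (subst (∣ x N ∣ ℚ.+ ∣ y N ∣ ℚ.<_) (half+half ε) (ℚ.+-mono-< s t))))

away-*ʳ : ∀ b x → Seq.Bounded b → Away (λ n → b n ℚ.* x n) → Away x
away-*ʳ b x (Seq.mkBounded B 0<B b≤B) (mkAway ε 0<ε ev) =
  mkAway (inv B ℚ.* ε) (*-pos (inv-pos 0<B) 0<ε)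
  (Seq.map (λ {n} (big , bd) →
      ℚ.*-cancelˡ-≤-pos B {{ℚ.positive 0<B}}
        (subst (ℚ._≤ B ℚ.* ∣ x n ∣) (sym (*-inv-cancel 0<B ε))
          (ℚ.≤-trans big
            (subst (ℚ._≤ B ℚ.* ∣ x n ∣) (sym (ℚ.∣p*q∣≡∣p∣*∣q∣ (b n) (x n)))
              (ℚ.*-monoʳ-≤-nonNeg ∣ x n ∣ {{ℚ.∣-∣-nonNeg (x n)}} bd)))))
    (Seq.both ev b≤B))

away-neg : ∀ {x} → Away x → Away (λ n → ℚ.- x n)
away-neg {x} (mkAway ε 0<ε ev) =
  mkAway ε 0<ε (Seq.map (λ {n} → subst (ε ℚ.≤_) (sym (ℚ.∣-p∣≡∣p∣ (x n)))) ev)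

away-squares : ∀ (x y : ℕ → ℚ) → Away x → Away (λ n → x n ℚ.* x n ℚ.+ y n ℚ.* y n)
away-squares x y (mkAway ε 0<ε ev) = mkAway (ε ℚ.* ε) (*-pos 0<ε 0<ε)
  (Seq.map (λ {n} p →
    let x²≤ = subst (ℚ._≤ x n ℚ.* x n ℚ.+ y n ℚ.* y n) (ℚ.+-identityʳ _)
                (ℚ.+-monoʳ-≤ (x n ℚ.* x n) (square-nonNeg (y n)))
        ∣x∣²≡x² = trans (sym (ℚ.∣p*q∣≡∣p∣*∣q∣ (x n) (x n)))
                    (ℚ.0≤p⇒∣p∣≡p (square-nonNeg (x n)))
    in subst (ε ℚ.* ε ℚ.≤_)
         (sym (ℚ.0≤p⇒∣p∣≡p (ℚ.≤-trans (square-nonNeg (x n)) x²≤)))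
         (ℚ.≤-trans
           (subst (ε ℚ.* ε ℚ.≤_) ∣x∣²≡x²
             (*-mono-≤ (ℚ.0≤∣p∣ (x n)) (ℚ.<⇒≤ 0<ε) p p))
           x²≤)) ev)

infixl 6 _+ᵣ_ _-ᵣ_
infixl 7 _*ᵣ_
infix  8 -ᵣ_

opaque
  fromℚ : ℚ → ℝ
  fromℚ q = mkℝ (λ _ → q) (cauchy-const q)

  _+ᵣ_ _*ᵣ_ : ℝ → ℝ → ℝ
  x +ᵣ y = mkℝ (λ n → seq x n ℚ.+ seq y n) (cauchy-+ (seq x) (seq y) (cauchy x) (cauchy y))
  x *ᵣ y = mkℝ (λ n → seq x n ℚ.* seq y n) (cauchy-* (seq x) (seq y) (cauchy x) (cauchy y))

  -ᵣ_ : ℝ → ℝ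
  -ᵣ x = mkℝ (λ n → ℚ.- seq x n) (cauchy-neg (seq x) (cauchy x))

_-ᵣ_ : ℝ → ℝ → ℝ
x -ᵣ y = x +ᵣ (-ᵣ y)

pointwise : ∀ {x y} → (∀ n → seq x n ≡ seq y n) → x ≈ᵣ y
pointwise {x} {y} eq = mk≈ (Seq.null-resp
  (Seq.always λ n → sym (trans (cong (ℚ._- seq y n) (eq n)) (ℚ.+-inverseʳ (seq y n))))
  Seq.null-0)

≈ᵣ-refl : ∀ {x} → x ≈ᵣ x
≈ᵣ-refl = pointwise (λ _ → refl)

≈ᵣ-sym : ∀ {x y} → x ≈ᵣ y → y ≈ᵣ x
≈ᵣ-sym {x} {y} (mk≈ p) = mk≈ (Seq.null-resp
  (Seq.always λ n → Id.neg-swap (seq x n) (seq y n))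
  (Seq.null-neg p))

≈ᵣ-trans : ∀ {x y z} → x ≈ᵣ y → y ≈ᵣ z → x ≈ᵣ z
≈ᵣ-trans {x} {y} {z} (mk≈ p) (mk≈ q) = mk≈ (Seq.null-resp
  (Seq.always λ n → Id.telescope (seq x n) (seq y n) (seq z n))
  (Seq.null-+ p q))

opaque
  unfolding _+ᵣ_

  +ᵣ-cong : ∀ {x y u v} → x ≈ᵣ y → u ≈ᵣ v → x +ᵣ u ≈ᵣ y +ᵣ v
  +ᵣ-cong {x} {y} {u} {v} (mk≈ p) (mk≈ q) = mk≈ (Seq.null-resp
    (Seq.always λ n → Id.-‿+ (seq x n) (seq y n) (seq u n) (seq v n))
    (Seq.null-+ p q))

  -ᵣ-cong : ∀ {x y} → x ≈ᵣ y → -ᵣ x ≈ᵣ -ᵣ y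
  -ᵣ-cong {x} {y} (mk≈ p) = mk≈ (Seq.null-resp
    (Seq.always λ n → Id.neg-- (seq x n) (seq y n))
    (Seq.null-neg p))

  *ᵣ-cong : ∀ {x y u v} → x ≈ᵣ y → u ≈ᵣ v → x *ᵣ u ≈ᵣ y *ᵣ v
  *ᵣ-cong {x} {y} {u} {v} (mk≈ p) (mk≈ q) = mk≈ (Seq.null-resp
    (Seq.always λ n → Id.-‿* (seq x n) (seq y n) (seq u n) (seq v n))
    (Seq.null-+ (Seq.null-* (cauchy⇒bounded (seq x) (cauchy x)) q)
              (Seq.null-* (cauchy⇒bounded (seq v) (cauchy v)) p)))

#ᵣ-sym : ∀ {x y} → x #ᵣ y → y #ᵣ x
#ᵣ-sym {x} {y} (mk# a) = mk# (away-resp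
  (λ n → Id.neg-swap (seq x n) (seq y n))
  (away-neg a))

opaque
  unfolding _+ᵣ_

  #ᵣ-cotrans : ∀ {x y} → x #ᵣ y → ∀ z → x #ᵣ z ⊎ z #ᵣ y
  #ᵣ-cotrans {x} {y} (mk# a) z = Sum.map mk# mk#
    (away-+ (seq (x -ᵣ z)) (seq (z -ᵣ y)) (cauchy (x -ᵣ z)) (cauchy (z -ᵣ y)) (away-resp
      (λ n → sym (Id.telescope (seq x n) (seq z n) (seq y n))) a))

#ᵣ-irrefl : ∀ {x y} → x ≈ᵣ y → ¬ x #ᵣ y
#ᵣ-irrefl (mk≈ p) (mk# a) = null⇒¬away p a

opaque
  unfolding _+ᵣ_

  #ᵣ-tight : ∀ {x y} → ¬ x #ᵣ y → x ≈ᵣ y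
  #ᵣ-tight {x} {y} ¬a = mk≈ (¬away⇒null (seq (x -ᵣ y)) (cauchy (x -ᵣ y)) (¬a ∘ mk#))

record Complex : Set where
  constructor _+i_
  field
    re im : ℝ
open Complex public

conj : Complex → Complex
conj (a +i b) = a +i (-ᵣ b)

module ComplexField where

  infix  4 _≈_ _#_
  infixl 6 _+_
  infixl 7 _*_
  infix  8 -_

  _≈_ _#_ : Complex → Complex → Set
  z ≈ w = re z ≈ᵣ re w × im z ≈ᵣ im w
  z # w = re z #ᵣ re w ⊎ im z #ᵣ im w

  _+_ _*_ : Complex → Complex → Complex
  (a +i b) + (c +i d) = (a +ᵣ c) +i (b +ᵣ d)
  (a +i b) * (c +i d) = (a *ᵣ c -ᵣ b *ᵣ d) +i (a *ᵣ d +ᵣ b *ᵣ c)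

  -_ : Complex → Complex
  - (a +i b) = (-ᵣ a) +i (-ᵣ b)

  0# 1# : Complex
  0# = fromℚ 0ℚ +i fromℚ 0ℚ
  1# = fromℚ 1ℚ +i fromℚ 0ℚ

  open import Algebra.Definitions _≈_ using (Invertible)

  *-cong : ∀ {z z′ w w′} → z ≈ z′ → w ≈ w′ → z * w ≈ z′ * w′
  *-cong (p , q) (r , s) =
    +ᵣ-cong (*ᵣ-cong p r) (-ᵣ-cong (*ᵣ-cong q s)) ,
    +ᵣ-cong (*ᵣ-cong p s) (*ᵣ-cong q r)

  ≈-trans : ∀ {u z w} → u ≈ z → z ≈ w → u ≈ w
  ≈-trans (p , q) (r , s) = ≈ᵣ-trans p r , ≈ᵣ-trans q s

  +-cong : ∀ {z z′ w w′} → z ≈ z′ → w ≈ w′ → z + w ≈ z′ + w′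
  +-cong (p , q) (r , s) = +ᵣ-cong p r , +ᵣ-cong q s

  opaque
    unfolding _+ᵣ_

    +-comm : ∀ z w → z + w ≈ w + z
    +-comm (a +i b) (c +i d) =
      pointwise (λ n → ℚ.+-comm (seq a n) (seq c n)) ,
      pointwise (λ n → ℚ.+-comm (seq b n) (seq d n))

    +-assoc : ∀ u z w → (u + z) + w ≈ u + (z + w)
    +-assoc (a +i b) (c +i d) (e +i f) =
      pointwise (λ n → ℚ.+-assoc (seq a n) (seq c n) (seq e n)) ,
      pointwise (λ n → ℚ.+-assoc (seq b n) (seq d n) (seq f n))

    +-identityˡ : ∀ z → 0# + z ≈ z
    +-identityˡ (a +i b) =
      pointwise (λ n → ℚ.+-identityˡ (seq a n)) , pointwise (λ n → ℚ.+-identityˡ (seq b n))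

    +-inverseʳ : ∀ z → z + - z ≈ 0#
    +-inverseʳ (a +i b) =
      pointwise (λ n → ℚ.+-inverseʳ (seq a n)) , pointwise (λ n → ℚ.+-inverseʳ (seq b n))

    *-comm : ∀ z w → z * w ≈ w * z
    *-comm (a +i b) (c +i d) =
      pointwise (λ n → Id.comm-re (seq a n) (seq b n) (seq c n) (seq d n)) ,
      pointwise (λ n → Id.comm-im (seq a n) (seq b n) (seq c n) (seq d n))

    *-assoc : ∀ u z w → (u * z) * w ≈ u * (z * w)
    *-assoc (a +i b) (c +i d) (e +i f) =
      pointwise (λ n → Id.assoc-re (seq a n) (seq b n) (seq c n) (seq d n) (seq e n) (seq f n)) ,
      pointwise (λ n → Id.assoc-im (seq a n) (seq b n) (seq c n) (seq d n) (seq e n) (seq f n))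

    *-identityˡ : ∀ z → 1# * z ≈ z
    *-identityˡ (a +i b) =
      pointwise (λ n → Id.unit-re (seq a n) (seq b n)) ,
      pointwise (λ n → Id.unit-im (seq a n) (seq b n))

    *-distribˡ-+ : ∀ u z w → u * (z + w) ≈ u * z + u * w
    *-distribˡ-+ (a +i b) (c +i d) (e +i f) =
      pointwise (λ n → Id.distrib-re (seq a n) (seq b n) (seq c n) (seq d n) (seq e n) (seq f n)) ,
      pointwise (λ n → Id.distrib-im (seq a n) (seq b n) (seq c n) (seq d n) (seq e n) (seq f n))

    -- The reciprocal is conj z / |z|².
    away⇒invertible : ∀ z → Away (seq (re z)) ⊎ Away (seq (im z)) → Invertible 1# _*_ z
    away⇒invertible z@(a +i b) away-z = z⁻¹ , ≈-trans (*-comm z⁻¹ z) z*z⁻¹≈1 , z*z⁻¹≈1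
      where

      ∣z∣² : ℝ
      ∣z∣² = a *ᵣ a +ᵣ b *ᵣ b

      away-∣z∣² : Away (seq ∣z∣²)
      away-∣z∣² = Sum.[ away-squares (seq a) (seq b)
                      , away-resp (λ n → ℚ.+-comm (seq b n ℚ.* seq b n) (seq a n ℚ.* seq a n)) ∘
                          away-squares (seq b) (seq a) ]′ away-z

      r : ℝ
      r = mkℝ (inv ∘ seq ∣z∣²) (cauchy-inv (seq ∣z∣²) away-∣z∣² (cauchy ∣z∣²))

      z⁻¹ : Complex
      z⁻¹ = (a *ᵣ r) +i (-ᵣ (b *ᵣ r))

      r*∣z∣²≡1 : Seq.Eventually (λ n → seq r n ℚ.* seq ∣z∣² n ≡ 1ℚ)
      r*∣z∣²≡1 = Seq.map (λ {n} ε≤ → inv-inverse (seq ∣z∣² n) (∣-∣-pos⇒≢0 (gap-pos away-∣z∣²) ε≤))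
                       (gap≤ away-∣z∣²)

      z*z⁻¹≈1 : z * z⁻¹ ≈ 1#
      z*z⁻¹≈1 =
        mk≈ (Seq.null-resp
          (Seq.map (λ {n} eq → sym (trans
              (cong (ℚ._- 1ℚ) (trans (Id.norm-re (seq a n) (seq b n) (seq r n)) eq))
              (ℚ.+-inverseʳ 1ℚ))) r*∣z∣²≡1)
          Seq.null-0) ,
        pointwise (λ n → Id.norm-im (seq a n) (seq b n) (seq r n))

    1#0 : fromℚ 1ℚ #ᵣ fromℚ 0ℚ
    1#0 = mk# (mkAway 1ℚ (ℚ.positive⁻¹ 1ℚ) (Seq.always λ _ → ℚ.≤-reflexive refl))

    re-apart : ∀ z → re z ≈ᵣ fromℚ 1ℚ → re z #ᵣ fromℚ 0ℚ
    re-apart z p = Sum.[ (λ h → contradiction h (#ᵣ-irrefl (≈ᵣ-sym p))) , (λ h → h) ]′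
                     (#ᵣ-cotrans 1#0 (re z))

    away-product : ∀ a b c d → re ((c +i d) * (a +i b)) #ᵣ fromℚ 0ℚ →
                   Away (λ n → seq c n ℚ.* seq a n ℚ.+ (ℚ.- seq d n) ℚ.* seq b n)
    away-product a b c d (mk# h) =
      away-resp (λ n → Id.difference (seq c n) (seq a n) (seq d n) (seq b n)) h

    invertible⇒away : ∀ z → Invertible 1# _*_ z → Away (seq (re z)) ⊎ Away (seq (im z))
    invertible⇒away (a +i b) ((c +i d) , (p , _) , _) = Sum.map
      (away-*ʳ (seq c) (seq a) (cauchy⇒bounded (seq c) (cauchy c)))
      (away-*ʳ (seq (-ᵣ d)) (seq b) (cauchy⇒bounded (seq (-ᵣ d)) (cauchy (-ᵣ d))))
      (away-+ (λ n → seq c n ℚ.* seq a n) (λ n → (ℚ.- seq d n) ℚ.* seq b n)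
        (cauchy (c *ᵣ a)) (cauchy ((-ᵣ d) *ᵣ b))
        (away-product a b c d (re-apart ((c +i d) * (a +i b)) p)))

    #⇒invertible : ∀ z w → z # w → Invertible 1# _*_ (z + - w)
    #⇒invertible z w = away⇒invertible (z + - w) ∘ Sum.map away away

    invertible⇒# : ∀ z w → Invertible 1# _*_ (z + - w) → z # w
    invertible⇒# z w = Sum.map mk# mk# ∘ invertible⇒away (z + - w)

  isHeytingField : IsHeytingField _≈_ _#_ _+_ _*_ -_ 0# 1#
  isHeytingField = record
    { isHeytingCommutativeRing = record
      { isCommutativeRing = record
        { isRing = record
          { +-isAbelianGroup = record
            { isGroup = record
              { isMonoid = record
                { isSemigroup = record
                  { isMagma = record
                    { isEquivalence = record
                      { refl  = ≈ᵣ-refl , ≈ᵣ-refl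
                      ; sym   = λ (p , q) → ≈ᵣ-sym p , ≈ᵣ-sym q
                      ; trans = ≈-trans
                      }
                    ; ∙-cong = +-cong
                    }
                  ; assoc = +-assoc
                  }
                ; identity = (λ z → +-identityˡ z)
                           , (λ z → ≈-trans (+-comm z 0#) (+-identityˡ z))
                }
              ; inverse = (λ z → ≈-trans (+-comm (- z) z) (+-inverseʳ z)) , +-inverseʳ
              ; ⁻¹-cong = λ (p , q) → -ᵣ-cong p , -ᵣ-cong q
              }
            ; comm = +-comm
            }
          ; *-cong = *-cong
          ; *-assoc = *-assoc
          ; *-identity = *-identityˡ , λ z → ≈-trans (*-comm z 1#) (*-identityˡ z)
          ; distrib = *-distribˡ-+
                    , λ u z w → ≈-trans (*-comm (z + w) u) (≈-trans (*-distribˡ-+ u z w)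
                                  (+-cong (*-comm u z) (*-comm u w)))
          }
        ; *-comm = *-comm
        }
      ; isApartnessRelation = record
        { irrefl = λ (p , q) → Sum.[ #ᵣ-irrefl p , #ᵣ-irrefl q ]′
        ; sym = Sum.map #ᵣ-sym #ᵣ-sym
        ; cotrans = λ
          { (inj₁ h) w → Sum.map inj₁ inj₁ (#ᵣ-cotrans h (re w))
          ; (inj₂ h) w → Sum.map inj₂ inj₂ (#ᵣ-cotrans h (im w)) }
        }
      ; #⇒invertible = λ {z} {w} → #⇒invertible z w
      ; invertible⇒# = λ {z} {w} → invertible⇒# z w
      }
    ; tight = λ z w → (λ ¬h → #ᵣ-tight (¬h ∘ inj₁) , #ᵣ-tight (¬h ∘ inj₂))
                    , λ (p , q) → Sum.[ #ᵣ-irrefl p , #ᵣ-irrefl q ]′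
    }

ℂ : HeytingField 0ℓ 0ℓ 0ℓ
ℂ = record { isHeytingField = ComplexField.isHeytingField }

module LinearAlgebra (K : HeytingField 0ℓ 0ℓ 0ℓ)
                     (conj : Op₁ (HeytingField.Carrier K)) where

  open HeytingField K
  open CommutativeRing (HeytingCommutativeRing.commutativeRing heytingCommutativeRing)
    using (+-monoid; +-rawMonoid)
  open import Algebra.Properties.Monoid.Sum +-monoid using (sum-syntax)
  open import Algebra.Definitions.RawMonoid +-rawMonoid using ()
    renaming (_×_ to _×ᴷ_)

  infix  4 _≋_ _≈ᴹ_
  infixl 6 _+ᵛ_ _-ᵛ_ _+ᴹ_
  infixl 7 _*ᴹ_ _*ᵛ_ _ᵛ*_
  infixr 7 _·ᵛ_ _·ᴹ_
  infix  9 _ᵀ _ᴴ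

  Vec : ℕ → Set
  Vec n = Vector Carrier n

  Matrix : ℕ → ℕ → Set
  Matrix m n = Vector (Vec n) m

  private variable
    l m n k : ℕ

  fromℕ : ℕ → Carrier
  fromℕ a = a ×ᴷ 1#

  _≋_ : Vec n → Vec n → Set
  x ≋ y = ∀ i → x i ≈ y i

  0ᵛ : Vec n
  0ᵛ _ = 0#

  _+ᵛ_ _-ᵛ_ : Vec n → Vec n → Vec n
  (x +ᵛ y) i = x i + y i
  (x -ᵛ y) i = x i - y i

  _·ᵛ_ : Carrier → Vec n → Vec n
  (c ·ᵛ x) i = c * x i

  combination : (Fin k → Carrier) → (Fin k → Vec n) → Vec n
  combination {k} c b i = ∑[ a < k ] (c a * b a i)

  ⟨_,_⟩ : Vec n → Vec n → Carrier
  ⟨_,_⟩ {n} x y = ∑[ i < n ] (conj (x i) * y i)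

  _≈ᴹ_ : Matrix m n → Matrix m n → Set
  M ≈ᴹ N = ∀ i → M i ≋ N i

  𝟙 : Matrix n n
  𝟙 i j = if does (i Fin.≟ j) then 1# else 0#

  𝕁 : Matrix m n
  𝕁 _ _ = 1#

  _+ᴹ_ : Matrix m n → Matrix m n → Matrix m n
  (M +ᴹ N) i = M i +ᵛ N i

  _·ᴹ_ : Carrier → Matrix m n → Matrix m n
  (c ·ᴹ M) i = c ·ᵛ M i

  combinationᴹ : (Fin k → Carrier) → (Fin k → Matrix m n) → Matrix m n
  combinationᴹ c B i = combination c (λ a → B a i)

  _*ᴹ_ : Matrix l m → Matrix m n → Matrix l n
  _*ᴹ_ {m = m} M N i j = ∑[ a < m ] (M i a * N a j)

  _*ᵛ_ : Matrix m n → Vec n → Vec m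
  _*ᵛ_ {n = n} M x i = ∑[ a < n ] (M i a * x a)

  _ᵛ*_ : Vec m → Matrix m n → Vec n
  _ᵛ*_ {m} x M j = ∑[ a < m ] (x a * M a j)

  _ᵀ : Matrix m n → Matrix n m
  (M ᵀ) i j = M j i

  _ᴴ : Matrix m n → Matrix n m
  (M ᴴ) i j = conj (M j i)

  tr : Matrix n n → Carrier
  tr {n} M = ∑[ i < n ] M i i

  ⟪_,_⟫ : Matrix m n → Matrix m n → Carrier
  ⟪ M , N ⟫ = tr (M ᴴ *ᴹ N)

  record IsSubspace (U : Pred (Vec n) 0ℓ) : Set where
    field
      resp     : ∀ {x y} → x ≋ y → x ∈ U → y ∈ U
      0-closed : 0ᵛ ∈ U
      +-closed : ∀ {x y} → x ∈ U → y ∈ U → (x +ᵛ y) ∈ U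
      ·-closed : ∀ c {x} → x ∈ U → (c ·ᵛ x) ∈ U

  columnSpace : Matrix m n → Pred (Vec m) 0ℓ
  columnSpace M x = ∃[ c ] x ≋ M *ᵛ c

  -- {w M : w ∈ U}, with the elements of U read as row vectors (no conjugation).
  rowImage : Pred (Vec m) 0ℓ → Matrix m n → Pred (Vec n) 0ℓ
  rowImage U M u = ∃[ w ] w ∈ U × u ≋ w ᵛ* M

  IsLinearlyIndependent : (Fin k → Vec n) → Set
  IsLinearlyIndependent b = ∀ c → combination c b ≋ 0ᵛ → ∀ a → c a ≈ 0#

  record IsBasis (U : Pred (Vec n) 0ℓ) (b : Fin k → Vec n) : Set where
    field
      member      : ∀ a → b a ∈ U
      independent : IsLinearlyIndependent b
      spanning    : ∀ {x} → x ∈ U → ∃[ c ] x ≋ combination c b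

  HasDimension : Pred (Vec n) 0ℓ → ℕ → Set
  HasDimension {n} U a = ∃[ b ] IsBasis {n} {a} U b

  record IsOrthogonalProjection (U : Pred (Vec n) 0ℓ) (M : Matrix n n) : Set where
    field
      image    : ∀ x → (M *ᵛ x) ∈ U
      residual : ∀ x {u} → u ∈ U → ⟨ u , x -ᵛ (M *ᵛ x) ⟩ ≈ 0#

  ActsAs : Carrier → Matrix n n → Pred (Vec n) 0ℓ → Set
  ActsAs θ M U = ∀ {w} → w ∈ U → M *ᵛ w ≋ θ ·ᵛ w

  -- The zero space is excluded through apartness, the constructive form of ≠.
  record IsCommonEigenspace (A : Fin k → Matrix n n) (U : Pred (Vec n) 0ℓ) : Set where
    field
      isSubspace : IsSubspace U
      nonzero    : ∃[ w ] w ∈ U × ∃[ x ] (w x # 0#)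
      eigenvalue : ∀ i → ∃[ θ ] ActsAs θ (A i) U

  record IsMaximalCommonEigenspace (A : Fin k → Matrix n n)
                                   (U : Pred (Vec n) 0ℓ) : Set₁ where
    field
      isCommonEigenspace : IsCommonEigenspace A U
      maximal            : ∀ U′ → IsCommonEigenspace A U′ → U ⊆ U′ → U′ ⊆ U

  record AreTheMaximalCommonEigenspaces (A : Fin k → Matrix n n)
                                        (W : Fin l → Pred (Vec n) 0ℓ) : Set₁ where
    field
      isMaximal  : ∀ j → IsMaximalCommonEigenspace A (W j)
      distinct   : ∀ {j j′} → W j ≐ W j′ → j ≡ j′
      exhaustive : ∀ U → IsMaximalCommonEigenspace A U → ∃[ j ] U ≐ W j

  data GeneratedAlgebra (A : Fin k → Matrix n n) : Pred (Matrix n n) 0ℓ where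
    generator : ∀ i → A i ∈ GeneratedAlgebra A
    one       : 𝟙 ∈ GeneratedAlgebra A
    add       : ∀ {M N} → M ∈ GeneratedAlgebra A → N ∈ GeneratedAlgebra A →
                (M +ᴹ N) ∈ GeneratedAlgebra A
    scale     : ∀ c {M} → M ∈ GeneratedAlgebra A → (c ·ᴹ M) ∈ GeneratedAlgebra A
    multiply  : ∀ {M N} → M ∈ GeneratedAlgebra A → N ∈ GeneratedAlgebra A →
                (M *ᴹ N) ∈ GeneratedAlgebra A
    resp      : ∀ {M N} → M ≈ᴹ N → M ∈ GeneratedAlgebra A → N ∈ GeneratedAlgebra A

open LinearAlgebra ℂ conj public

indicator : ∀ {m n} → (Fin m → Fin n → Bool) → Matrix m n
indicator R x y = if R x y then 1# else 0#
  where open HeytingField ℂ using (0#; 1#)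

record AssociationScheme (v d : ℕ) : Set where
  field
    R        : Fin (suc d) → Fin v → Fin v → Bool
    nonempty : ∀ i → ∃[ x ] ∃[ y ] R i x y ≡ true

  A : Fin (suc d) → Matrix v v
  A i = indicator (R i)

  field
    A₀≈𝟙      : A zero ≈ᴹ 𝟙
    ∑A≈𝕁      : combinationᴹ (λ _ → HeytingField.1# ℂ) A ≈ᴹ 𝕁
    transpose : ∀ i → ∃[ j ] (A i) ᵀ ≈ᴹ A j
    product   : ∀ i j → ∃[ p ] A i *ᴹ A j ≈ᴹ combinationᴹ p A

  IsSymmetric : Set
  IsSymmetric = ∀ i → (A i) ᵀ ≈ᴹ A i

  BoseMesnerAlgebra : Pred (Matrix v v) 0ℓ
  BoseMesnerAlgebra = GeneratedAlgebra A

-- A partition of Fin v into t non-empty cells C₀, …, Cₜ₋₁, given by the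
-- function sending a point to the index of its cell.
record Partition (v t : ℕ) : Set where
  field
    cell     : Fin v → Fin t
    nonempty : ∀ k → ∃[ x ] cell x ≡ k

  characteristicMatrix : Matrix v t
  characteristicMatrix = indicator (λ x k → does (cell x Fin.≟ k))

IsEquitable : ∀ {v d t} → AssociationScheme v d → Partition v t → Set
IsEquitable 𝒜 π = ∀ {M} → M ∈ BoseMesnerAlgebra → ∃[ B ] M *ᴹ H ≈ᴹ H *ᴹ B
  where
  open AssociationScheme 𝒜
  open Partition π renaming (characteristicMatrix to H)

{-# OPTIONS --safe #-}

-- By maximality W_j consists of all x with A_i x = P_ji x for every i.  Since H is real and
-- A_i H = H N_i, the symmetric matrix A_i preserves the column space of H and so commutes with
-- F; hence F preserves W_j and, being Hermitian, commutes with E_j.  So F E_j is idempotent.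
-- Every idempotent factors as B C with C B = 1_r, whence ⟨F, E_j⟩ = tr (F E_j) = r.  Finally
-- w ↦ w H kills the orthogonal complement of the column space and is injective on it, so it
-- carries the columns of B to a basis of W_j H, and r = dim (W_j H).
module Submission where

open import Defs using (module LinearAlgebra)
open import Level using (0ℓ)
open import Data.Nat.Base using (ℕ; zero; suc)
open import Data.Fin.Base using (Fin; zero; suc)
import Data.Fin.Properties as Fin
open import Data.Bool.Base using (Bool; true; false)
open import Data.Rational.Base as ℚ using (ℚ; 0ℚ; ∣_∣)
import Data.Rational.Properties as ℚ
open import Data.Product.Base using (∃-syntax; _×_; _,_; proj₁; proj₂)
open import Data.Sum.Base as Sum using (_⊎_; inj₁; inj₂)
open import Data.Vec.Functional using (tail)
open import Algebra.Core using (Op₁)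
open import Algebra.Bundles using (CommutativeRing)
open import Relation.Binary.Bundles using (Setoid)
import Relation.Binary.Reasoning.Setoid as SetoidReasoning
open import Relation.Binary.PropositionalEquality as ≡ using (_≡_; subst)
open import Relation.Nullary using (does; contradiction)
open import Relation.Nullary.Decidable using (dec⇒maybe)
open import Tactic.RingSolver using (solve-∀)
open import Tactic.RingSolver.Core.AlmostCommutativeRing
  using (AlmostCommutativeRing; fromCommutativeRing)
open import Relation.Unary using (Pred; _∈_)
open import Algebra.Apartness using (HeytingField; HeytingCommutativeRing)

-- Matrix algebra over a Heyting field.

module MatrixAlgebra (K : HeytingField 0ℓ 0ℓ 0ℓ)
                     (conjugate : Op₁ (HeytingField.Carrier K)) where

  open HeytingField K hiding (zero)
  open LinearAlgebra K conjugate
  private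
    commutativeRing : CommutativeRing 0ℓ 0ℓ
    commutativeRing = HeytingCommutativeRing.commutativeRing heytingCommutativeRing
  open CommutativeRing commutativeRing public
    using (ring; semiring; *-commutativeSemigroup)
  open import Algebra.Properties.Ring ring public
    using (-1*x≈-x; x[y-z]≈xy-xz; [y-z]x≈yx-zx; x∙y⁻¹≈ε⇒x≈y; x≈y⇒x∙y⁻¹≈ε)
    renaming (//-rightDividesˡ to [y-x]+x≈y; //-rightDividesʳ to [y+x]-x≈y)
  open import Algebra.Properties.Semiring.Sum semiring public
  open import Algebra.Properties.CommutativeSemigroup *-commutativeSemigroup public
    using (x∙yz≈y∙xz; x∙yz≈xy∙z)
  open import Algebra.Apartness.Properties.HeytingCommutativeRing heytingCommutativeRing
    using (1#0; x-0≈x)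
  module ≈-Reasoning = SetoidReasoning setoid

  private variable
    k l m n p : ℕ

  ≈ᴹ-setoid : ℕ → ℕ → Setoid 0ℓ 0ℓ
  ≈ᴹ-setoid m n = record
    { Carrier = Matrix m n
    ; _≈_ = _≈ᴹ_
    ; isEquivalence = record
      { refl = λ _ _ → refl
      ; sym = λ p i j → sym (p i j)
      ; trans = λ p q i j → trans (p i j) (q i j)
      }
    }

  ≋-setoid : ℕ → Setoid 0ℓ 0ℓ
  ≋-setoid n = record
    { Carrier = Vec n
    ; _≈_ = _≋_
    ; isEquivalence = record
      { refl = λ _ → refl
      ; sym = λ p i → sym (p i)
      ; trans = λ p q i → trans (p i) (q i)
      }
    }

  module ≈ᴹ-Reasoning {m n} = SetoidReasoning (≈ᴹ-setoid m n)
  module ≋-Reasoning {n} = SetoidReasoning (≋-setoid n)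

  column : Matrix m n → Fin n → Vec m
  column M j i = M i j

  sum-zero : {x : Vec n} → x ≋ 0ᵛ → sum x ≈ 0#
  sum-zero {n} x≋0 = trans (sum-cong-≋ x≋0) (sum-replicate-zero n)

  -- The one interchange of summations behind every associativity law below: these are its instances
  -- at a row or a column of a matrix.
  ᵛ*-*ᵛ-assoc : ∀ (x : Vec m) (M : Matrix m n) (y : Vec n) →
    ∑[ b < n ] ((x ᵛ* M) b * y b) ≈ ∑[ a < m ] (x a * (M *ᵛ y) a)
  ᵛ*-*ᵛ-assoc {m} {n} x M y = begin
    ∑[ b < n ] ((x ᵛ* M) b * y b)
      ≈⟨ sum-cong-≋ (λ b → *-distribʳ-sum (y b) (λ a → x a * M a b)) ⟩
    ∑[ b < n ] ∑[ a < m ] (x a * M a b * y b)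
      ≈⟨ ∑-comm (λ b a → x a * M a b * y b) ⟩
    ∑[ a < m ] ∑[ b < n ] (x a * M a b * y b)
      ≈⟨ sum-cong-≋ (λ a → sum-cong-≋ (λ b → *-assoc (x a) (M a b) (y b))) ⟩
    ∑[ a < m ] ∑[ b < n ] (x a * (M a b * y b))
      ≈⟨ sum-cong-≋ (λ a → *-distribˡ-sum (x a) (λ b → M a b * y b)) ⟨
    ∑[ a < m ] (x a * (M *ᵛ y) a) ∎
    where open ≈-Reasoning

  *ᴹ-assoc : ∀ (L : Matrix l m) (M : Matrix m n) (N : Matrix n p) →
             (L *ᴹ M) *ᴹ N ≈ᴹ L *ᴹ (M *ᴹ N)
  *ᴹ-assoc L M N i j = ᵛ*-*ᵛ-assoc (L i) M (column N j)

  *ᵛ-assoc : ∀ (L : Matrix l m) (M : Matrix m n) (x : Vec n) →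
             (L *ᴹ M) *ᵛ x ≋ L *ᵛ (M *ᵛ x)
  *ᵛ-assoc L M x i = ᵛ*-*ᵛ-assoc (L i) M x

  ᵛ*-assoc : ∀ (x : Vec l) (L : Matrix l m) (M : Matrix m n) →
             (x ᵛ* L) ᵛ* M ≋ x ᵛ* (L *ᴹ M)
  ᵛ*-assoc x L M j = ᵛ*-*ᵛ-assoc x L (column M j)

  *ᴹ-cong : {M M′ : Matrix l m} {N N′ : Matrix m n} →
            M ≈ᴹ M′ → N ≈ᴹ N′ → M *ᴹ N ≈ᴹ M′ *ᴹ N′
  *ᴹ-cong p q i j = sum-cong-≋ (λ a → *-cong (p i a) (q a j))

  *ᴹ-congˡ : ∀ (M : Matrix l m) {N N′ : Matrix m n} → N ≈ᴹ N′ → M *ᴹ N ≈ᴹ M *ᴹ N′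
  *ᴹ-congˡ M q = *ᴹ-cong {M = M} (λ _ _ → refl) q

  *ᴹ-congʳ : ∀ {M M′ : Matrix l m} (N : Matrix m n) → M ≈ᴹ M′ → M *ᴹ N ≈ᴹ M′ *ᴹ N
  *ᴹ-congʳ N p = *ᴹ-cong {N = N} p (λ _ _ → refl)

  *ᵛ-congˡ : ∀ (M : Matrix m n) {x y : Vec n} → x ≋ y → M *ᵛ x ≋ M *ᵛ y
  *ᵛ-congˡ M p i = sum-cong-≋ (λ a → *-congˡ (p a))

  *ᵛ-congʳ : ∀ {M N : Matrix m n} (x : Vec n) → M ≈ᴹ N → M *ᵛ x ≋ N *ᵛ x
  *ᵛ-congʳ x p i = sum-cong-≋ (λ a → *-congʳ (p i a))

  ᵛ*-cong : {x y : Vec m} {M N : Matrix m n} → x ≋ y → M ≈ᴹ N → x ᵛ* M ≋ y ᵛ* N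
  ᵛ*-cong p q j = sum-cong-≋ (λ a → *-cong (p a) (q a j))

  ᵛ*-ᵀ : ∀ (x : Vec n) (M : Matrix m n) → x ᵛ* M ᵀ ≋ M *ᵛ x
  ᵛ*-ᵀ x M i = sum-cong-≋ (λ a → *-comm (x a) (M i a))

  *ᵛ-·ᵛ : ∀ (M : Matrix m n) c x → M *ᵛ (c ·ᵛ x) ≋ c ·ᵛ (M *ᵛ x)
  *ᵛ-·ᵛ M c x i = trans (sum-cong-≋ (λ a → x∙yz≈y∙xz (M i a) c (x a)))
                        (sym (*-distribˡ-sum c (λ a → M i a * x a)))

  *ᵛ-+ᵛ : ∀ (M : Matrix m n) x y → M *ᵛ (x +ᵛ y) ≋ (M *ᵛ x) +ᵛ (M *ᵛ y)
  *ᵛ-+ᵛ M x y i = trans (sum-cong-≋ (λ a → distribˡ (M i a) (x a) (y a)))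
                        (∑-distrib-+ (λ a → M i a * x a) (λ a → M i a * y a))

  *ᵛ-0ᵛ : ∀ (M : Matrix m n) → M *ᵛ 0ᵛ ≋ 0ᵛ
  *ᵛ-0ᵛ M i = sum-zero (λ a → zeroʳ (M i a))

  -- Induction works because `𝟙 (suc i) (suc j)` reduces to `𝟙 i j`, while the entries with exactly
  -- one index `zero` reduce to `0#`.
  *ᵛ-identityˡ : (x : Vec n) → 𝟙 *ᵛ x ≋ x
  *ᵛ-identityˡ x zero = trans
    (+-cong (*-identityˡ (x zero)) (sum-zero (λ a → zeroˡ (x (suc a)))))
    (+-identityʳ (x zero))
  *ᵛ-identityˡ x (suc i) = trans
    (+-cong (zeroˡ (x zero)) (*ᵛ-identityˡ (λ a → x (suc a)) i))
    (+-identityˡ (x (suc i)))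

  ᵛ*-identityʳ : (x : Vec n) → x ᵛ* 𝟙 ≋ x
  ᵛ*-identityʳ x zero = trans
    (+-cong (*-identityʳ (x zero)) (sum-zero (λ a → zeroʳ (x (suc a)))))
    (+-identityʳ (x zero))
  ᵛ*-identityʳ x (suc i) = trans
    (+-cong (zeroʳ (x zero)) (ᵛ*-identityʳ (λ a → x (suc a)) i))
    (+-identityˡ (x (suc i)))

  *ᴹ-identityʳ : (M : Matrix m n) → M *ᴹ 𝟙 ≈ᴹ M
  *ᴹ-identityʳ M i = ᵛ*-identityʳ (M i)

  *ᴹ-identityˡ : (M : Matrix m n) → 𝟙 *ᴹ M ≈ᴹ M
  *ᴹ-identityˡ M i j = *ᵛ-identityˡ (column M j) i

  tr-comm : ∀ (M : Matrix m n) (N : Matrix n m) → tr (M *ᴹ N) ≈ tr (N *ᴹ M)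
  tr-comm M N = trans
    (∑-comm (λ i a → M i a * N a i))
    (sum-cong-≋ (λ a → sum-cong-≋ (λ i → *-comm (M i a) (N a i))))

  tr-cong : {M N : Matrix n n} → M ≈ᴹ N → tr M ≈ tr N
  tr-cong p = sum-cong-≋ (λ i → p i i)

  𝟙-diagonal : (i : Fin n) → 𝟙 i i ≈ 1#
  𝟙-diagonal zero    = refl
  𝟙-diagonal (suc i) = 𝟙-diagonal i

  tr-𝟙 : ∀ n → tr (𝟙 {n}) ≈ fromℕ n
  tr-𝟙 n = trans (sum-cong-≋ {n} 𝟙-diagonal) (sum-replicate n)

  ∑-neg : (x : Vec n) → ∑[ a < n ] (- x a) ≈ - sum x
  ∑-neg {n} x = begin
    ∑[ a < n ] (- x a)        ≈⟨ sum-cong-≋ (λ a → -1*x≈-x (x a)) ⟨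
    ∑[ a < n ] (- 1# * x a)   ≈⟨ *-distribˡ-sum (- 1#) x ⟨
    - 1# * sum x              ≈⟨ -1*x≈-x (sum x) ⟩
    - sum x                   ∎
    where open ≈-Reasoning

  ∑-distrib-- : (x y : Vec n) → ∑[ a < n ] (x a - y a) ≈ sum x - sum y
  ∑-distrib-- x y = trans (∑-distrib-+ x (λ a → - y a)) (+-congˡ (∑-neg y))

  -- Rank factorization of idempotent matrices.

  IsIdempotent : Matrix n n → Set
  IsIdempotent M = M *ᴹ M ≈ᴹ M

  -- The columns of `B` are a basis of the image of `M`, and `C` reads off coordinates in it. Having
  -- a left inverse `C` for `B` yields both linear independence and, by cyclicity of the trace,
  -- `tr M` as a natural number.
  record RankFactorization (M : Matrix n n) : Set where
    field
      rank : ℕ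
      B    : Matrix n rank
      C    : Matrix rank n
      BC≈M : B *ᴹ C ≈ᴹ M
      CB≈𝟙 : C *ᴹ B ≈ᴹ 𝟙

    MB≈B : M *ᴹ B ≈ᴹ B
    MB≈B = begin
      M *ᴹ B          ≈⟨ *ᴹ-congʳ B BC≈M ⟨
      (B *ᴹ C) *ᴹ B   ≈⟨ *ᴹ-assoc B C B ⟩
      B *ᴹ (C *ᴹ B)   ≈⟨ *ᴹ-congˡ B CB≈𝟙 ⟩
      B *ᴹ 𝟙          ≈⟨ *ᴹ-identityʳ B ⟩
      B               ∎
      where open ≈ᴹ-Reasoning

    CM≈C : C *ᴹ M ≈ᴹ C
    CM≈C = begin
      C *ᴹ M          ≈⟨ *ᴹ-congˡ C BC≈M ⟨
      C *ᴹ (B *ᴹ C)   ≈⟨ *ᴹ-assoc C B C ⟨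
      (C *ᴹ B) *ᴹ C   ≈⟨ *ᴹ-congʳ C CB≈𝟙 ⟩
      𝟙 *ᴹ C          ≈⟨ *ᴹ-identityˡ C ⟩
      C               ∎
      where open ≈ᴹ-Reasoning

    trace : tr M ≈ fromℕ rank
    trace = begin
      tr M            ≈⟨ tr-cong BC≈M ⟨
      tr (B *ᴹ C)     ≈⟨ tr-comm B C ⟩
      tr (C *ᴹ B)     ≈⟨ tr-cong CB≈𝟙 ⟩
      tr (𝟙 {rank})   ≈⟨ tr-𝟙 rank ⟩
      fromℕ rank      ∎
      where open ≈-Reasoning

  -- This lets an idempotent be replaced by a smaller one with the same rank. If `B C = Y X`, then
  -- `(X B)(C Y) = X (Y X) Y` is the square of `M`, and `C (Y X) B = C B`.
  swapFactorization : ∀ {M : Matrix n n} → IsIdempotent M →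
    (X : Matrix n k) (Y : Matrix k n) → X *ᴹ Y ≈ᴹ M →
    RankFactorization (Y *ᴹ X) → RankFactorization M
  swapFactorization {M = M} M²≈M X Y XY≈M f = record
    { rank = rank
    ; B = X *ᴹ B
    ; C = C *ᴹ Y
    ; BC≈M = begin
        (X *ᴹ B) *ᴹ (C *ᴹ Y)     ≈⟨ *ᴹ-assoc X B (C *ᴹ Y) ⟩
        X *ᴹ (B *ᴹ (C *ᴹ Y))     ≈⟨ *ᴹ-congˡ X (*ᴹ-assoc B C Y) ⟨
        X *ᴹ ((B *ᴹ C) *ᴹ Y)     ≈⟨ *ᴹ-congˡ X (*ᴹ-congʳ Y BC≈M) ⟩
        X *ᴹ ((Y *ᴹ X) *ᴹ Y)     ≈⟨ *ᴹ-congˡ X (*ᴹ-assoc Y X Y) ⟩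
        X *ᴹ (Y *ᴹ (X *ᴹ Y))     ≈⟨ *ᴹ-assoc X Y (X *ᴹ Y) ⟨
        (X *ᴹ Y) *ᴹ (X *ᴹ Y)     ≈⟨ *ᴹ-cong XY≈M XY≈M ⟩
        M *ᴹ M                   ≈⟨ M²≈M ⟩
        M                        ∎
    ; CB≈𝟙 = begin
        (C *ᴹ Y) *ᴹ (X *ᴹ B)     ≈⟨ *ᴹ-assoc C Y (X *ᴹ B) ⟩
        C *ᴹ (Y *ᴹ (X *ᴹ B))     ≈⟨ *ᴹ-congˡ C (*ᴹ-assoc Y X B) ⟨
        C *ᴹ ((Y *ᴹ X) *ᴹ B)     ≈⟨ *ᴹ-congˡ C MB≈B ⟩
        C *ᴹ B                   ≈⟨ CB≈𝟙 ⟩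
        𝟙                        ∎
    }
    where
    open RankFactorization f
    open ≈ᴹ-Reasoning

  -- Rank-one deflation: subtracting the outer product of a right and a left fixed vector of `M`,
  -- normalised to pair to 1, splits one dimension off the image.
  module Deflation (M : Matrix n n) (u v : Vec n) (Mu≋u : M *ᵛ u ≋ u) (vM≋v : v ᵛ* M ≋ v)
                   (v·u≈1 : ∑[ a < n ] (v a * u a) ≈ 1#) where

    deflated : Matrix n n
    deflated i j = M i j - u i * v j

    deflated-*ᵛ : ∀ x i → (deflated *ᵛ x) i ≈ (M *ᵛ x) i - u i * ∑[ a < n ] (v a * x a)
    deflated-*ᵛ x i = begin
      ∑[ a < n ] ((M i a - u i * v a) * x a)
        ≈⟨ sum-cong-≋ (λ a → [y-z]x≈yx-zx (x a) (M i a) (u i * v a)) ⟩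
      ∑[ a < n ] (M i a * x a - u i * v a * x a)
        ≈⟨ ∑-distrib-- (λ a → M i a * x a) (λ a → u i * v a * x a) ⟩
      (M *ᵛ x) i - ∑[ a < n ] (u i * v a * x a)
        ≈⟨ +-congˡ (-‿cong (sum-cong-≋ (λ a → *-assoc (u i) (v a) (x a)))) ⟩
      (M *ᵛ x) i - ∑[ a < n ] (u i * (v a * x a))
        ≈⟨ +-congˡ (-‿cong (*-distribˡ-sum (u i) (λ a → v a * x a))) ⟨
      (M *ᵛ x) i - u i * ∑[ a < n ] (v a * x a) ∎
      where open ≈-Reasoning

    ᵛ*-deflated : ∀ x j → (x ᵛ* deflated) j ≈ (x ᵛ* M) j - ∑[ a < n ] (x a * u a) * v j
    ᵛ*-deflated x j = begin
      ∑[ a < n ] (x a * (M a j - u a * v j))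
        ≈⟨ sum-cong-≋ (λ a → x[y-z]≈xy-xz (x a) (M a j) (u a * v j)) ⟩
      ∑[ a < n ] (x a * M a j - x a * (u a * v j))
        ≈⟨ ∑-distrib-- (λ a → x a * M a j) (λ a → x a * (u a * v j)) ⟩
      (x ᵛ* M) j - ∑[ a < n ] (x a * (u a * v j))
        ≈⟨ +-congˡ (-‿cong (sum-cong-≋ (λ a → *-assoc (x a) (u a) (v j)))) ⟨
      (x ᵛ* M) j - ∑[ a < n ] (x a * u a * v j)
        ≈⟨ +-congˡ (-‿cong (*-distribʳ-sum (v j) (λ a → x a * u a))) ⟨
      (x ᵛ* M) j - ∑[ a < n ] (x a * u a) * v j ∎
      where open ≈-Reasoning

    deflated*u≋0 : deflated *ᵛ u ≋ 0ᵛ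
    deflated*u≋0 i = trans (deflated-*ᵛ u i)
      (x≈y⇒x∙y⁻¹≈ε (trans (Mu≋u i) (sym (trans (*-congˡ v·u≈1) (*-identityʳ (u i))))))

    v*deflated≋0 : v ᵛ* deflated ≋ 0ᵛ
    v*deflated≋0 j = trans (ᵛ*-deflated v j)
      (x≈y⇒x∙y⁻¹≈ε (trans (vM≋v j) (sym (trans (*-congʳ v·u≈1) (*-identityˡ (v j))))))

    -- Expanding the right factor leaves `deflated *ᴹ M`, since `deflated` kills `u`. Expanding the
    -- left factor then gives `M *ᴹ M` minus the outer product of `u` with `v ᵛ* M`, which is `v`.
    deflated-idempotent : IsIdempotent M → IsIdempotent deflated
    deflated-idempotent M²≈M i j = begin
      (deflated *ᴹ deflated) i j
        ≈⟨ ᵛ*-deflated (deflated i) j ⟩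
      (deflated *ᴹ M) i j - (deflated *ᵛ u) i * v j
        ≈⟨ +-congˡ (-‿cong (trans (*-congʳ (deflated*u≋0 i)) (zeroˡ (v j)))) ⟩
      (deflated *ᴹ M) i j - 0#
        ≈⟨ x-0≈x _ ⟩
      (deflated *ᴹ M) i j
        ≈⟨ deflated-*ᵛ (column M j) i ⟩
      (M *ᴹ M) i j - u i * (v ᵛ* M) j
        ≈⟨ +-cong (M²≈M i j) (-‿cong (*-congˡ (vM≋v j))) ⟩
      deflated i j ∎
      where open ≈-Reasoning

    -- Borders `B` by the column `u` and `C` by the row `v`. The mixed entries of the product vanish
    -- because `B` and `C` absorb `deflated`, which is annihilated by `v` on the left and by `u` on
    -- the right.
    inflate : RankFactorization deflated → RankFactorization M
    inflate f = record
      { rank = suc rank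
      ; B = B⁺
      ; C = C⁺
      ; BC≈M = λ i j → begin
          u i * v j + (B *ᴹ C) i j              ≈⟨ +-congˡ (BC≈M i j) ⟩
          u i * v j + (M i j - u i * v j)       ≈⟨ +-comm _ _ ⟩
          (M i j - u i * v j) + u i * v j       ≈⟨ [y-x]+x≈y (u i * v j) (M i j) ⟩
          M i j                                 ∎
      ; CB≈𝟙 = C⁺B⁺≈𝟙
      }
      where
      open RankFactorization f
      open ≈-Reasoning
      B⁺ : Matrix n (suc rank)
      B⁺ i zero    = u i
      B⁺ i (suc a) = B i a
      C⁺ : Matrix (suc rank) n
      C⁺ zero    = v
      C⁺ (suc a) = C a
      C⁺B⁺≈𝟙 : C⁺ *ᴹ B⁺ ≈ᴹ 𝟙
      C⁺B⁺≈𝟙 zero zero = v·u≈1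
      C⁺B⁺≈𝟙 zero (suc b) = begin
        (v ᵛ* B) b                   ≈⟨ ᵛ*-cong {x = v} (λ _ → refl) MB≈B b ⟨
        (v ᵛ* (deflated *ᴹ B)) b     ≈⟨ ᵛ*-assoc v deflated B b ⟨
        ((v ᵛ* deflated) ᵛ* B) b     ≈⟨ sum-zero (λ a → trans (*-congʳ (v*deflated≋0 a)) (zeroˡ (B a b))) ⟩
        0#                           ∎
      C⁺B⁺≈𝟙 (suc a) zero = begin
        (C *ᵛ u) a                   ≈⟨ *ᵛ-congʳ u CM≈C a ⟨
        ((C *ᴹ deflated) *ᵛ u) a     ≈⟨ *ᵛ-assoc C deflated u a ⟩
        (C *ᵛ (deflated *ᵛ u)) a     ≈⟨ *ᵛ-congˡ C deflated*u≋0 a ⟩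
        (C *ᵛ 0ᵛ) a                  ≈⟨ *ᵛ-0ᵛ C a ⟩
        0#                           ∎
      C⁺B⁺≈𝟙 (suc a) (suc b) = CB≈𝟙 a b

  -- The induction hypothesis on the size, passed explicitly to the two pivot cases.
  FactorsIdempotents : ℕ → Set
  FactorsIdempotents n = ∀ (M : Matrix n n) → IsIdempotent M → RankFactorization M

  -- If 1 − M₀₀ is invertible, then M² = M expresses row 0 of M through the other rows.
  factorWithoutPivot : FactorsIdempotents n → ∀ (M : Matrix (suc n) (suc n)) → IsIdempotent M →
    ∀ {c} → c * (1# - M zero zero) ≈ 1# → RankFactorization M
  factorWithoutPivot {n} factors M M²≈M {c} c[1-g]≈1 =
    swapFactorization M²≈M X Y XY≈M (factors (Y *ᴹ X) YX-idempotent)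
    where
    g : Carrier
    g = M zero zero
    Y : Matrix n (suc n)
    Y i = M (suc i)
    X : Matrix (suc n) n
    -- `c` is the inverse of `1# - g`, which solves row 0 of `M *ᴹ M ≈ᴹ M` for row 0 of `M`; the
    -- other rows of `M` are the rows of `Y` themselves, whence the identity block.
    X zero    a = c * M zero (suc a)
    X (suc i) a = 𝟙 i a
    XY≈M : X *ᴹ Y ≈ᴹ M
    XY≈M zero j = begin
      ∑[ a < n ] (c * M zero (suc a) * Y a j)
        ≈⟨ sum-cong-≋ (λ a → *-assoc c (M zero (suc a)) (Y a j)) ⟩
      ∑[ a < n ] (c * (M zero (suc a) * Y a j))
        ≈⟨ *-distribˡ-sum c (λ a → M zero (suc a) * Y a j) ⟨
      c * s
        ≈⟨ *-congˡ ([y+x]-x≈y (g * M zero j) s) ⟨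
      c * (s + g * M zero j - g * M zero j)
        ≈⟨ *-congˡ (+-congʳ (trans (+-comm s _) (M²≈M zero j))) ⟩
      c * (M zero j - g * M zero j)
        ≈⟨ *-congˡ (+-congʳ (*-identityˡ (M zero j))) ⟨
      c * (1# * M zero j - g * M zero j)
        ≈⟨ *-congˡ ([y-z]x≈yx-zx (M zero j) 1# g) ⟨
      c * ((1# - g) * M zero j)
        ≈⟨ x∙yz≈xy∙z c (1# - g) (M zero j) ⟩
      c * (1# - g) * M zero j
        ≈⟨ *-congʳ c[1-g]≈1 ⟩
      1# * M zero j
        ≈⟨ *-identityˡ (M zero j) ⟩
      M zero j ∎
      where
      open ≈-Reasoning
      s : Carrier
      s = ∑[ a < n ] (M zero (suc a) * Y a j)
    XY≈M (suc i) = *ᴹ-identityˡ Y i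
    -- Regrouping gives `Y (X Y) X = Y M X`, and `Y M = Y` because the rows of `Y` are rows of the
    -- idempotent `M`.
    YX-idempotent : IsIdempotent (Y *ᴹ X)
    YX-idempotent = begin
      (Y *ᴹ X) *ᴹ (Y *ᴹ X)   ≈⟨ *ᴹ-assoc Y X (Y *ᴹ X) ⟩
      Y *ᴹ (X *ᴹ (Y *ᴹ X))   ≈⟨ *ᴹ-congˡ Y (*ᴹ-assoc X Y X) ⟨
      Y *ᴹ ((X *ᴹ Y) *ᴹ X)   ≈⟨ *ᴹ-congˡ Y (*ᴹ-congʳ X XY≈M) ⟩
      Y *ᴹ (M *ᴹ X)          ≈⟨ *ᴹ-assoc Y M X ⟨
      (Y *ᴹ M) *ᴹ X          ≈⟨ *ᴹ-congʳ X (λ i → M²≈M (suc i)) ⟩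
      Y *ᴹ X                 ∎
      where open ≈ᴹ-Reasoning

  -- Deflating by column 0 and the scaled row 0 leaves a matrix with zero pivot.
  factorWithPivot : FactorsIdempotents n → ∀ (M : Matrix (suc n) (suc n)) → IsIdempotent M →
    ∀ {h} → h * M zero zero ≈ 1# → RankFactorization M
  factorWithPivot {n} factors M M²≈M {h} hg≈1 =
    inflate (factorWithoutPivot factors deflated (deflated-idempotent M²≈M) pivot)
    where
    -- The factor `h` normalises: `v` paired with column 0 is `h` times the corner of `M *ᴹ M`, that
    -- is `h * M zero zero`.
    v : Vec (suc n)
    v = h ·ᵛ M zero
    v·column : ∀ j → ∑[ a < suc n ] (v a * M a j) ≈ v j
    v·column j = trans (sum-cong-≋ (λ a → *-assoc h (M zero a) (M a j)))
      (trans (sym (*-distribˡ-sum h (λ a → M zero a * M a j))) (*-congˡ (M²≈M zero j)))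
    open Deflation M (column M zero) v (λ i → M²≈M i zero) v·column (trans (v·column zero) hg≈1)
    pivot : 1# * (1# - deflated zero zero) ≈ 1#
    pivot = begin
      1# * (1# - deflated zero zero)
        ≈⟨ *-identityˡ _ ⟩
      1# - deflated zero zero
        ≈⟨ +-congˡ (-‿cong (x≈y⇒x∙y⁻¹≈ε (sym (trans (*-congˡ hg≈1) (*-identityʳ _))))) ⟩
      1# - 0#
        ≈⟨ x-0≈x 1# ⟩
      1# ∎
      where open ≈-Reasoning

  -- Whether a pivot is zero cannot be decided in a Heyting field. But `1#` is apart from `0#`, so
  -- by cotransitivity the corner entry is apart from one of them, and either case reduces the size.
  rankFactorization : FactorsIdempotents n
  rankFactorization {zero} M _ = record
    { rank = 0 ; B = M ; C = M ; BC≈M = λ () ; CB≈𝟙 = λ () }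
  rankFactorization {suc n} M M²≈M with #-cotrans 1#0 (M zero zero)
  ... | inj₁ 1#g = factorWithoutPivot rankFactorization M M²≈M (proj₁ (proj₂ (#⇒invertible 1#g)))
  ... | inj₂ g#0 = factorWithPivot rankFactorization M M²≈M
        -- Apartness from `0#` inverts the difference with `0#`, which must be rewritten to the
        -- entry itself.
        (trans (*-congˡ (sym (x-0≈x _))) (proj₁ (proj₂ (#⇒invertible g#0))))

-- Conjugation, adjoints and the Hermitian inner product.

record IsConjugation (K : HeytingField 0ℓ 0ℓ 0ℓ)
                     (conjugate : Op₁ (HeytingField.Carrier K)) : Set where
  open HeytingField K
  open LinearAlgebra K conjugate
  field
    conj-cong       : ∀ {x y} → x ≈ y → conjugate x ≈ conjugate y
    conj-0#         : conjugate 0# ≈ 0#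
    conj-+          : ∀ x y → conjugate (x + y) ≈ conjugate x + conjugate y
    conj-*          : ∀ x y → conjugate (x * y) ≈ conjugate x * conjugate y
    conj-involutive : ∀ x → conjugate (conjugate x) ≈ x
    -- Stated for vectors of every length, because an abstract Heyting field has no order in which
    -- to express positivity of the summands.
    definite        : ∀ {n} (x : Vec n) → ⟨ x , x ⟩ ≈ 0# → x ≋ 0ᵛ

module InnerProductSpace {K : HeytingField 0ℓ 0ℓ 0ℓ}
                         {conjugate : Op₁ (HeytingField.Carrier K)}
                         (isConjugation : IsConjugation K conjugate) where

  open HeytingField K hiding (zero)
  open LinearAlgebra K conjugate hiding (resp)
  open MatrixAlgebra K conjugate
  open IsConjugation isConjugation

  private variable
    k l m n t v : ℕ

  conj-∑ : (x : Vec n) → conjugate (sum x) ≈ ∑[ a < n ] conjugate (x a)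
  conj-∑ {zero}  x = conj-0#
  conj-∑ {suc n} x = trans (conj-+ (x zero) _) (+-congˡ (conj-∑ (λ a → x (suc a))))

  ᴴ-cong : {M N : Matrix m n} → M ≈ᴹ N → M ᴴ ≈ᴹ N ᴴ
  ᴴ-cong p i j = conj-cong (p j i)

  ᴴ-involutive : (M : Matrix m n) → (M ᴴ) ᴴ ≈ᴹ M
  ᴴ-involutive M i j = conj-involutive (M i j)

  ᴴ-*ᴹ : ∀ (M : Matrix l m) (N : Matrix m n) → (M *ᴹ N) ᴴ ≈ᴹ N ᴴ *ᴹ M ᴴ
  ᴴ-*ᴹ {m = m} M N i j = begin
    conjugate (∑[ a < m ] (M j a * N a i))
      ≈⟨ conj-∑ (λ a → M j a * N a i) ⟩
    ∑[ a < m ] conjugate (M j a * N a i)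
      ≈⟨ sum-cong-≋ (λ a → trans (conj-* (M j a) (N a i)) (*-comm _ _)) ⟩
    ∑[ a < m ] (conjugate (N a i) * conjugate (M j a)) ∎
    where open ≈-Reasoning

  ⟨,⟩-adjoint : ∀ (M : Matrix m n) x y → ⟨ M *ᵛ x , y ⟩ ≈ ⟨ x , M ᴴ *ᵛ y ⟩
  ⟨,⟩-adjoint {m} {n} M x y = trans
    (sum-cong-≋ (λ i → *-congʳ (conj-*ᵛ i)))
    (ᵛ*-*ᵛ-assoc (λ a → conjugate (x a)) (M ᴴ) y)
    where
    conj-*ᵛ : ∀ i → conjugate ((M *ᵛ x) i) ≈ ((λ a → conjugate (x a)) ᵛ* M ᴴ) i
    conj-*ᵛ i = trans (conj-∑ (λ a → M i a * x a))
      (sum-cong-≋ (λ a → trans (conj-* (M i a) (x a)) (*-comm _ _)))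

  ⟨,⟩-cong : {x x′ y y′ : Vec n} → x ≋ x′ → y ≋ y′ → ⟨ x , y ⟩ ≈ ⟨ x′ , y′ ⟩
  ⟨,⟩-cong p q = sum-cong-≋ (λ i → *-cong (conj-cong (p i)) (q i))

  ⟨,⟩--ᵛ : (x y z : Vec n) → ⟨ x , y -ᵛ z ⟩ ≈ ⟨ x , y ⟩ - ⟨ x , z ⟩
  ⟨,⟩--ᵛ x y z = trans
    (sum-cong-≋ (λ i → x[y-z]≈xy-xz (conjugate (x i)) (y i) (z i)))
    (∑-distrib-- (λ i → conjugate (x i) * y i) (λ i → conjugate (x i) * z i))

  -ᵛ-closed : {U : Pred (Vec n) 0ℓ} → IsSubspace U → ∀ {x y} → x ∈ U → y ∈ U → (x -ᵛ y) ∈ U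
  -ᵛ-closed isSubspace {x} {y} x∈U y∈U =
    resp (λ i → +-congˡ (-1*x≈-x (y i))) (+-closed x∈U (·-closed (- 1#) y∈U))
    where open IsSubspace isSubspace

  columnSpace-isSubspace : (M : Matrix m n) → IsSubspace (columnSpace M)
  columnSpace-isSubspace M = record
    { resp     = λ { x≋y (c , p) → c , λ i → trans (sym (x≋y i)) (p i) }
    ; 0-closed = 0ᵛ , λ i → sym (*ᵛ-0ᵛ M i)
    ; +-closed = λ { (c , p) (c′ , p′) →
        c +ᵛ c′ , λ i → trans (+-cong (p i) (p′ i)) (sym (*ᵛ-+ᵛ M c c′ i)) }
    ; ·-closed = λ { s (c , p) →
        s ·ᵛ c , λ i → trans (*-congˡ (p i)) (sym (*ᵛ-·ᵛ M s c i)) }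
    }

  column∈columnSpace : ∀ (M : Matrix m n) j → column M j ∈ columnSpace M
  column∈columnSpace M j = column 𝟙 j , λ i → sym (*ᴹ-identityʳ M i j)

  -- Orthogonal projections.

  module Projection {U : Pred (Vec n) 0ℓ} (isSubspace : IsSubspace U)
                    {Q : Matrix n n} (isProjection : IsOrthogonalProjection U Q) where

    open IsSubspace isSubspace
    open IsOrthogonalProjection isProjection

    -- The residual `x -ᵛ Q *ᵛ x` lies in `U` and is orthogonal to `U`, hence to itself.
    fixes : ∀ {x} → x ∈ U → Q *ᵛ x ≋ x
    fixes {x} x∈U i = sym (x∙y⁻¹≈ε⇒x≈y (x i) ((Q *ᵛ x) i)
      (definite (x -ᵛ Q *ᵛ x) (residual x (-ᵛ-closed isSubspace x∈U (image x))) i))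

    ⟨,⟩-projection : ∀ {u} → u ∈ U → ∀ x → ⟨ u , x ⟩ ≈ ⟨ u , Q *ᵛ x ⟩
    ⟨,⟩-projection {u} u∈U x = x∙y⁻¹≈ε⇒x≈y _ _
      (trans (sym (⟨,⟩--ᵛ u x (Q *ᵛ x))) (residual x u∈U))

    column∈U : ∀ j → column Q j ∈ U
    column∈U j = resp (λ i → *ᴹ-identityʳ Q i j) (image (column 𝟙 j))

    -- It suffices that `Q ᴴ` equals `Q ᴴ *ᴹ Q`, which is visibly Hermitian.
    hermitian : Q ᴴ ≈ᴹ Q
    hermitian = begin
      Q ᴴ                ≈⟨ Qᴴ≈QᴴQ ⟩
      Q ᴴ *ᴹ Q           ≈⟨ *ᴹ-congˡ (Q ᴴ) (ᴴ-involutive Q) ⟨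
      Q ᴴ *ᴹ (Q ᴴ) ᴴ     ≈⟨ ᴴ-*ᴹ (Q ᴴ) Q ⟨
      (Q ᴴ *ᴹ Q) ᴴ       ≈⟨ ᴴ-cong Qᴴ≈QᴴQ ⟨
      (Q ᴴ) ᴴ            ≈⟨ ᴴ-involutive Q ⟩
      Q                  ∎
      where
      open ≈ᴹ-Reasoning
      Qᴴ≈QᴴQ : Q ᴴ ≈ᴹ Q ᴴ *ᴹ Q
      Qᴴ≈QᴴQ = begin
        Q ᴴ                  ≈⟨ *ᴹ-identityʳ (Q ᴴ) ⟨
        -- Entries of `Q ᴴ *ᴹ 𝟙` are inner products with columns of `Q`; as these lie in `U`, the
        -- other argument may be projected.
        Q ᴴ *ᴹ 𝟙             ≈⟨ (λ i j → ⟨,⟩-projection (column∈U i) (column 𝟙 j)) ⟩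
        Q ᴴ *ᴹ (Q *ᴹ 𝟙)      ≈⟨ *ᴹ-congˡ (Q ᴴ) (*ᴹ-identityʳ Q) ⟩
        Q ᴴ *ᴹ Q             ∎

    idempotent : IsIdempotent Q
    idempotent i j = fixes (column∈U j) i

    -- Invariance of `U` says `Q M Q = M Q`. The left side is Hermitian, so `M Q` equals its own
    -- adjoint `Q M`.
    commutes : ∀ {M} → M ᴴ ≈ᴹ M → (∀ {x} → x ∈ U → (M *ᵛ x) ∈ U) → M *ᴹ Q ≈ᴹ Q *ᴹ M
    commutes {M} Mᴴ≈M preserves = begin
      M *ᴹ Q                  ≈⟨ QMQ≈MQ ⟨
      Q *ᴹ (M *ᴹ Q)           ≈⟨ *ᴹ-assoc Q M Q ⟨
      (Q *ᴹ M) *ᴹ Q           ≈⟨ *ᴹ-cong [MQ]ᴴ≈QM hermitian ⟨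
      (M *ᴹ Q) ᴴ *ᴹ Q ᴴ       ≈⟨ ᴴ-*ᴹ Q (M *ᴹ Q) ⟨
      (Q *ᴹ (M *ᴹ Q)) ᴴ       ≈⟨ ᴴ-cong QMQ≈MQ ⟩
      (M *ᴹ Q) ᴴ              ≈⟨ [MQ]ᴴ≈QM ⟩
      Q *ᴹ M                  ∎
      where
      open ≈ᴹ-Reasoning
      QMQ≈MQ : Q *ᴹ (M *ᴹ Q) ≈ᴹ M *ᴹ Q
      QMQ≈MQ i j = fixes (preserves (column∈U j)) i
      [MQ]ᴴ≈QM : (M *ᴹ Q) ᴴ ≈ᴹ Q *ᴹ M
      [MQ]ᴴ≈QM = begin
        (M *ᴹ Q) ᴴ    ≈⟨ ᴴ-*ᴹ M Q ⟩
        Q ᴴ *ᴹ M ᴴ    ≈⟨ *ᴹ-cong hermitian Mᴴ≈M ⟩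
        Q *ᴹ M        ∎

  -- The eigenvectors for the eigenvalues of W form a common eigenspace containing W, so
  -- maximality leaves nothing outside W.
  eigenvector∈maximal : {A : Fin k → Matrix n n} {W : Pred (Vec n) 0ℓ} →
    IsMaximalCommonEigenspace A W → (θ : Fin k → Carrier) → (∀ i → ActsAs (θ i) (A i) W) →
    ∀ {x} → (∀ i → A i *ᵛ x ≋ θ i ·ᵛ x) → x ∈ W
  eigenvector∈maximal {k} {n} {A} {W} isMaximal θ acts =
    maximal Eigenvectors isEigenspace (λ w∈W i → acts i w∈W)
    where
    open IsMaximalCommonEigenspace isMaximal
    open IsCommonEigenspace isCommonEigenspace
    Eigenvectors : Pred (Vec n) 0ℓ
    Eigenvectors x = ∀ i → A i *ᵛ x ≋ θ i ·ᵛ x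
    isEigenspace : IsCommonEigenspace A Eigenvectors
    isEigenspace = record
      { isSubspace = record
        { resp = λ {x} {y} x≋y Ax≋θx i j → trans (sym (*ᵛ-congˡ (A i) x≋y j))
            (trans (Ax≋θx i j) (*-congˡ (x≋y j)))
        ; 0-closed = λ i j → trans (*ᵛ-0ᵛ (A i) j) (sym (zeroʳ (θ i)))
        ; +-closed = λ {x} {y} p q i j → trans (*ᵛ-+ᵛ (A i) x y j)
            (trans (+-cong (p i j) (q i j)) (sym (distribˡ (θ i) (x j) (y j))))
        ; ·-closed = λ c {x} p i j → trans (*ᵛ-·ᵛ (A i) c x j)
            (trans (*-congˡ (p i j)) (x∙yz≈y∙xz c (θ i) (x j)))
        }
      ; nonzero = let (w , w∈W , x , wx#0) = nonzero in w , (λ i → acts i w∈W) , x , wx#0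
      ; eigenvalue = λ i → θ i , λ x∈ → x∈ i
      }

  -- The idempotent `F *ᴹ E` and the row space `rowImage W H`.

  module InvariantColumnSpace
    {A : Fin k → Matrix v v} (symmetric : ∀ i → (A i) ᵀ ≈ᴹ A i) (real : ∀ i → (A i) ᴴ ≈ᴹ (A i) ᵀ)
    {W : Pred (Vec v) 0ℓ} (isMaximal : IsMaximalCommonEigenspace A W)
    {E : Matrix v v} (isProjectionE : IsOrthogonalProjection W E)
    (θ : Fin k → Carrier) (acts : ∀ i → ActsAs (θ i) (A i) W)
    (H : Matrix v t) (H-real : H ᴴ ≈ᴹ H ᵀ)
    (N : Fin k → Matrix t t) (AH≈HN : ∀ i → A i *ᴹ H ≈ᴹ H *ᴹ N i)
    {F : Matrix v v} (isProjectionF : IsOrthogonalProjection (columnSpace H) F)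
    where

    open IsMaximalCommonEigenspace isMaximal using (isCommonEigenspace)
    open IsCommonEigenspace isCommonEigenspace using (isSubspace)
    open IsSubspace isSubspace using (resp)
    open IsOrthogonalProjection isProjectionE using (image)
    module F = Projection (columnSpace-isSubspace H) isProjectionF
    module E = Projection isSubspace isProjectionE

    A-hermitian : ∀ i → (A i) ᴴ ≈ᴹ A i
    A-hermitian i x y = trans (real i x y) (symmetric i x y)

    A-preserves-columnSpace : ∀ i {x} → x ∈ columnSpace H → (A i *ᵛ x) ∈ columnSpace H
    A-preserves-columnSpace i {x} (c , x≋Hc) = N i *ᵛ c , (begin
      A i *ᵛ x             ≈⟨ *ᵛ-congˡ (A i) x≋Hc ⟩
      A i *ᵛ (H *ᵛ c)      ≈⟨ *ᵛ-assoc (A i) H c ⟨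
      (A i *ᴹ H) *ᵛ c      ≈⟨ *ᵛ-congʳ c (AH≈HN i) ⟩
      (H *ᴹ N i) *ᵛ c      ≈⟨ *ᵛ-assoc H (N i) c ⟩
      H *ᵛ (N i *ᵛ c)      ∎)
      where open ≋-Reasoning

    -- `F` commutes with every `A i`, so `F *ᵛ w` solves the same eigenvalue equations as `w`, and
    -- maximality returns it to `W`.
    F-preserves-W : ∀ {w} → w ∈ W → (F *ᵛ w) ∈ W
    F-preserves-W {w} w∈W = eigenvector∈maximal isMaximal θ acts λ i → begin
      A i *ᵛ (F *ᵛ w)      ≈⟨ *ᵛ-assoc (A i) F w ⟨
      (A i *ᴹ F) *ᵛ w      ≈⟨ *ᵛ-congʳ w (F.commutes (A-hermitian i) (A-preserves-columnSpace i)) ⟩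
      (F *ᴹ A i) *ᵛ w      ≈⟨ *ᵛ-assoc F (A i) w ⟩
      F *ᵛ (A i *ᵛ w)      ≈⟨ *ᵛ-congˡ F (acts i w∈W) ⟩
      F *ᵛ (θ i ·ᵛ w)      ≈⟨ *ᵛ-·ᵛ F (θ i) w ⟩
      θ i ·ᵛ (F *ᵛ w)      ∎
      where open ≋-Reasoning

    -- The commutation argument a second time, now with `F` as the Hermitian matrix and `W` as the
    -- invariant subspace.
    FE≈EF : F *ᴹ E ≈ᴹ E *ᴹ F
    FE≈EF = E.commutes F.hermitian F-preserves-W

    FE-idempotent : IsIdempotent (F *ᴹ E)
    FE-idempotent = begin
      (F *ᴹ E) *ᴹ (F *ᴹ E)     ≈⟨ *ᴹ-congˡ (F *ᴹ E) FE≈EF ⟩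
      (F *ᴹ E) *ᴹ (E *ᴹ F)     ≈⟨ *ᴹ-assoc F E (E *ᴹ F) ⟩
      F *ᴹ (E *ᴹ (E *ᴹ F))     ≈⟨ *ᴹ-congˡ F (*ᴹ-assoc E E F) ⟨
      F *ᴹ ((E *ᴹ E) *ᴹ F)     ≈⟨ *ᴹ-congˡ F (*ᴹ-congʳ F E.idempotent) ⟩
      F *ᴹ (E *ᴹ F)            ≈⟨ *ᴹ-congˡ F FE≈EF ⟨
      F *ᴹ (F *ᴹ E)            ≈⟨ *ᴹ-assoc F F E ⟨
      (F *ᴹ F) *ᴹ E            ≈⟨ *ᴹ-congʳ E F.idempotent ⟩
      F *ᴹ E                   ∎
      where open ≈ᴹ-Reasoning

    open RankFactorization (rankFactorization (F *ᴹ E) FE-idempotent) public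
      using (rank; B; C; BC≈M; CB≈𝟙; MB≈B; trace)

    inner-product : ⟪ F , E ⟫ ≈ fromℕ rank
    inner-product = trans (tr-cong (*ᴹ-congʳ E F.hermitian)) trace

    -- Symmetry of `A i` makes `w` a row eigenvector too, without conjugating `θ i`; the relation
    -- `A H = H N` then carries it across `H`.
    ᵛ*-eigenvector : ∀ i {u} → u ∈ rowImage W H → u ᵛ* N i ≋ θ i ·ᵛ u
    ᵛ*-eigenvector i {u} (w , w∈W , u≋wH) = begin
      u ᵛ* N i             ≈⟨ ᵛ*-cong u≋wH (λ _ _ → refl) ⟩
      (w ᵛ* H) ᵛ* N i      ≈⟨ ᵛ*-assoc w H (N i) ⟩
      w ᵛ* (H *ᴹ N i)      ≈⟨ ᵛ*-cong {x = w} (λ _ → refl) (AH≈HN i) ⟨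
      w ᵛ* (A i *ᴹ H)      ≈⟨ ᵛ*-assoc w (A i) H ⟨
      (w ᵛ* A i) ᵛ* H      ≈⟨ ᵛ*-cong {M = H} wA≋θw (λ _ _ → refl) ⟩
      (θ i ·ᵛ w) ᵛ* H      ≈⟨ (λ j → sum-cong-≋ (λ a → *-assoc (θ i) (w a) (H a j))) ⟩
      (λ j → ∑[ a < v ] (θ i * (w a * H a j)))
                           ≈⟨ (λ j → *-distribˡ-sum (θ i) (λ a → w a * H a j)) ⟨
      θ i ·ᵛ (w ᵛ* H)      ≈⟨ (λ j → *-congˡ (u≋wH j)) ⟨
      θ i ·ᵛ u             ∎
      where
      open ≋-Reasoning
      wA≋θw : w ᵛ* A i ≋ θ i ·ᵛ w
      wA≋θw = begin
        w ᵛ* A i         ≈⟨ ᵛ*-cong {x = w} (λ _ → refl) (symmetric i) ⟨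
        w ᵛ* (A i) ᵀ     ≈⟨ ᵛ*-ᵀ w (A i) ⟩
        A i *ᵛ w         ≈⟨ acts i w∈W ⟩
        θ i ·ᵛ w         ∎

    -- The columns of `B` are fixed by `F E = E F`, so they lie in the image of `E`; `FB≈B` is the
    -- counterpart for `F`.
    column-B∈W : ∀ a → column B a ∈ W
    column-B∈W a = resp (λ x → EFB≈B x a) (image (column (F *ᴹ B) a))
      where
      open ≈ᴹ-Reasoning
      EFB≈B : E *ᴹ (F *ᴹ B) ≈ᴹ B
      EFB≈B = begin
        E *ᴹ (F *ᴹ B)   ≈⟨ *ᴹ-assoc E F B ⟨
        (E *ᴹ F) *ᴹ B   ≈⟨ *ᴹ-congʳ B FE≈EF ⟨
        (F *ᴹ E) *ᴹ B   ≈⟨ MB≈B ⟩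
        B               ∎

    FB≈B : F *ᴹ B ≈ᴹ B
    FB≈B = begin
      F *ᴹ B                   ≈⟨ *ᴹ-congˡ F MB≈B ⟨
      F *ᴹ ((F *ᴹ E) *ᴹ B)     ≈⟨ *ᴹ-assoc F (F *ᴹ E) B ⟨
      (F *ᴹ (F *ᴹ E)) *ᴹ B     ≈⟨ *ᴹ-congʳ B (*ᴹ-assoc F F E) ⟨
      ((F *ᴹ F) *ᴹ E) *ᴹ B     ≈⟨ *ᴹ-congʳ B (*ᴹ-congʳ E F.idempotent) ⟩
      (F *ᴹ E) *ᴹ B            ≈⟨ MB≈B ⟩
      B                        ∎
      where open ≈ᴹ-Reasoning

    Hᴴ*ᵛ : ∀ x → H ᴴ *ᵛ x ≋ x ᵛ* H
    Hᴴ*ᵛ x j = sum-cong-≋ (λ a → trans (*-congʳ (H-real j a)) (*-comm _ _))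

    -- Since `H` is real, the entries of `x ᵛ* H` are inner products of `x` with the columns of `H`,
    -- and projecting `x` onto their span changes none of them.
    F-ᵛ*H : ∀ x → (F *ᵛ x) ᵛ* H ≋ x ᵛ* H
    F-ᵛ*H x j = begin
      ((F *ᵛ x) ᵛ* H) j           ≈⟨ Hᴴ*ᵛ (F *ᵛ x) j ⟨
      ⟨ column H j , F *ᵛ x ⟩     ≈⟨ F.⟨,⟩-projection (column∈columnSpace H j) x ⟨
      ⟨ column H j , x ⟩          ≈⟨ Hᴴ*ᵛ x j ⟩
      (x ᵛ* H) j                  ∎
      where open ≈-Reasoning

    -- Such an `x` is orthogonal to all columns of `H` and also a combination of them, hence
    -- orthogonal to itself.
    columnSpace-ᵛ*H-injective : ∀ {x} → x ∈ columnSpace H → x ᵛ* H ≋ 0ᵛ → x ≋ 0ᵛ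
    columnSpace-ᵛ*H-injective {x} (c , x≋Hc) xH≋0 = definite x (begin
      ⟨ x , x ⟩             ≈⟨ ⟨,⟩-cong {y = x} x≋Hc (λ _ → refl) ⟩
      ⟨ H *ᵛ c , x ⟩        ≈⟨ ⟨,⟩-adjoint H c x ⟩
      ⟨ c , H ᴴ *ᵛ x ⟩      ≈⟨ sum-zero (λ j → trans (*-congˡ (trans (Hᴴ*ᵛ x j) (xH≋0 j))) (zeroʳ _)) ⟩
      0#                    ∎)
      where open ≈-Reasoning

    rowImageBasis : Fin rank → Vec t
    rowImageBasis = B ᵀ *ᴹ H

    combination-rowImageBasis : ∀ c → combination c rowImageBasis ≋ (B *ᵛ c) ᵛ* H
    combination-rowImageBasis c = begin
      c ᵛ* (B ᵀ *ᴹ H)      ≈⟨ ᵛ*-assoc c (B ᵀ) H ⟨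
      (c ᵛ* B ᵀ) ᵛ* H      ≈⟨ ᵛ*-cong {M = H} (ᵛ*-ᵀ c B) (λ _ _ → refl) ⟩
      (B *ᵛ c) ᵛ* H        ∎
      where open ≋-Reasoning

    rowImageBasis-isBasis : IsBasis (rowImage W H) rowImageBasis
    rowImageBasis-isBasis = record
      { member = λ a → column B a , column-B∈W a , λ _ → refl
      ; independent = independent
      ; spanning = spanning
      }
      where
      open ≋-Reasoning
      independent : IsLinearlyIndependent rowImageBasis
      -- Injectivity on the column space gives `B *ᵛ c ≋ 0ᵛ`; the left inverse `C` then recovers
      -- `c`.
      independent c comb≋0 = begin
        c                  ≈⟨ *ᵛ-identityˡ c ⟨
        𝟙 *ᵛ c             ≈⟨ *ᵛ-congʳ c CB≈𝟙 ⟨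
        (C *ᴹ B) *ᵛ c      ≈⟨ *ᵛ-assoc C B c ⟩
        C *ᵛ (B *ᵛ c)      ≈⟨ *ᵛ-congˡ C (columnSpace-ᵛ*H-injective Bc∈columnSpace BcH≋0) ⟩
        C *ᵛ 0ᵛ            ≈⟨ *ᵛ-0ᵛ C ⟩
        0ᵛ                 ∎
        where
        Bc∈columnSpace : (B *ᵛ c) ∈ columnSpace H
        Bc∈columnSpace = IsSubspace.resp (columnSpace-isSubspace H)
          (λ i → trans (sym (*ᵛ-assoc F B c i)) (*ᵛ-congʳ c FB≈B i))
          (IsOrthogonalProjection.image isProjectionF (B *ᵛ c))
        BcH≋0 : (B *ᵛ c) ᵛ* H ≋ 0ᵛ
        BcH≋0 j = trans (sym (combination-rowImageBasis c j)) (comb≋0 j)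
      spanning : ∀ {u} → u ∈ rowImage W H → ∃[ c ] u ≋ combination c rowImageBasis
      -- The coordinates are `C *ᵛ w`: `B C w = F E w = F w`, which has the same image under `H` as
      -- `w`.
      spanning {u} (w , w∈W , u≋wH) = C *ᵛ w , (begin
        u                                        ≈⟨ u≋wH ⟩
        w ᵛ* H                                   ≈⟨ F-ᵛ*H w ⟨
        (F *ᵛ w) ᵛ* H                            ≈⟨ ᵛ*-cong {M = H} Fw≋BCw (λ _ _ → refl) ⟩
        (B *ᵛ (C *ᵛ w)) ᵛ* H                     ≈⟨ combination-rowImageBasis (C *ᵛ w) ⟨
        combination (C *ᵛ w) rowImageBasis       ∎)
        where
        Fw≋BCw : F *ᵛ w ≋ B *ᵛ (C *ᵛ w)
        Fw≋BCw = begin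
          F *ᵛ w               ≈⟨ *ᵛ-congˡ F (E.fixes w∈W) ⟨
          F *ᵛ (E *ᵛ w)        ≈⟨ *ᵛ-assoc F E w ⟨
          (F *ᴹ E) *ᵛ w        ≈⟨ *ᵛ-congʳ w BC≈M ⟨
          (B *ᴹ C) *ᵛ w        ≈⟨ *ᵛ-assoc B C w ⟩
          B *ᵛ (C *ᵛ w)        ∎

open import Defs

-- Definiteness of the Hermitian form over the complex numbers.

private
  ℚ-ring : AlmostCommutativeRing 0ℓ 0ℓ
  ℚ-ring = fromCommutativeRing ℚ.+-*-commutativeRing (λ p → dec⇒maybe (0ℚ ℚ.≟ p))

  module Identity where
    open import Data.Rational.Base using (_+_; _-_; _*_; -_)

    conj-*-re : ∀ a b c d → a * c - b * d ≡ a * c - - b * - d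
    conj-*-re = solve-∀ ℚ-ring

    conj-*-im : ∀ a b c d → - (a * d + b * c) ≡ a * - d + - b * c
    conj-*-im = solve-∀ ℚ-ring

    neg-involutive : ∀ a → - - a ≡ a
    neg-involutive = solve-∀ ℚ-ring

    norm : ∀ a b → a * a + b * b ≡ a * a - - b * b
    norm = solve-∀ ℚ-ring

square-nonNeg : ∀ p → 0ℚ ℚ.≤ p ℚ.* p
square-nonNeg p with ℚ.≤-total 0ℚ p
... | inj₁ 0≤p = ℚ.nonNegative⁻¹ (p ℚ.* p)
        {{ℚ.nonNeg*nonNeg⇒nonNeg p {{ℚ.nonNegative 0≤p}} p {{ℚ.nonNegative 0≤p}}}}
... | inj₂ p≤0 = ℚ.nonNegative⁻¹ (p ℚ.* p)
        {{ℚ.nonPos*nonPos⇒nonPos p {{ℚ.nonPositive p≤0}} p {{ℚ.nonPositive p≤0}}}}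

-- Nonnegative terms cannot cancel, so the gap of `x` still serves for the sum.
away-+-nonNeg : ∀ (x y : ℕ → ℚ) → (∀ k → 0ℚ ℚ.≤ x k) → (∀ k → 0ℚ ℚ.≤ y k) →
                Away x → Away (λ k → x k ℚ.+ y k)
away-+-nonNeg x y 0≤x 0≤y (mkAway ε 0<ε ε≤) = mkAway ε 0<ε (Seq.map (λ {k} → step k) ε≤)
  where
  open ℚ.≤-Reasoning
  step : ∀ k → ε ℚ.≤ ∣ x k ∣ → ε ℚ.≤ ∣ x k ℚ.+ y k ∣
  step k ε≤∣x∣ = begin
    ε                 ≤⟨ ε≤∣x∣ ⟩
    ∣ x k ∣           ≡⟨ ℚ.0≤p⇒∣p∣≡p (0≤x k) ⟩
    x k               ≡⟨ ℚ.+-identityʳ (x k) ⟨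
    x k ℚ.+ 0ℚ        ≤⟨ ℚ.+-monoʳ-≤ (x k) (0≤y k) ⟩
    x k ℚ.+ y k       ≡⟨ ℚ.0≤p⇒∣p∣≡p (ℚ.+-mono-≤ (0≤x k) (0≤y k)) ⟨
    ∣ x k ℚ.+ y k ∣   ∎

open HeytingField ℂ using (Carrier; _≈_; _#_; 0#)

-- A condition on the representing sequence, not invariant under `_≈ᵣ_`. Squared moduli and their
-- sums satisfy it term by term, so no limit argument is needed.
NonNegative : ℝ → Set
NonNegative x = ∀ k → 0ℚ ℚ.≤ seq x k

0ᵣ : ℝ
0ᵣ = fromℚ 0ℚ

opaque
  unfolding _+ᵣ_

  0ᵣ-nonNeg : NonNegative 0ᵣ
  0ᵣ-nonNeg _ = ℚ.≤-refl

  +ᵣ-nonNeg : ∀ x y → NonNegative x → NonNegative y → NonNegative (x +ᵣ y)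
  +ᵣ-nonNeg x y 0≤x 0≤y k = ℚ.+-mono-≤ (0≤x k) (0≤y k)

  +ᵣ-comm : ∀ x y → x +ᵣ y ≈ᵣ y +ᵣ x
  +ᵣ-comm x y = pointwise (λ k → ℚ.+-comm (seq x k) (seq y k))

  away⇒#0 : ∀ x → Away (seq x) → x #ᵣ 0ᵣ
  away⇒#0 x away-x = mk# (away-resp (λ k → ≡.sym (ℚ.+-identityʳ (seq x k))) away-x)

  #0⇒away : ∀ x → x #ᵣ 0ᵣ → Away (seq x)
  #0⇒away x (mk# away-x) = away-resp (λ k → ℚ.+-identityʳ (seq x k)) away-x

  +ᵣ-#0ˡ : ∀ x y → NonNegative x → NonNegative y → x #ᵣ 0ᵣ → x +ᵣ y #ᵣ 0ᵣ
  +ᵣ-#0ˡ x y 0≤x 0≤y x#0 =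
    away⇒#0 (x +ᵣ y) (away-+-nonNeg (seq x) (seq y) 0≤x 0≤y (#0⇒away x x#0))

  norm-nonNeg : ∀ z → NonNegative (re (conj z ComplexField.* z))
  norm-nonNeg (a +i b) k = subst (0ℚ ℚ.≤_) (Identity.norm (seq a k) (seq b k))
    (ℚ.+-mono-≤ (square-nonNeg (seq a k)) (square-nonNeg (seq b k)))

  away-norm : ∀ a b → Away (seq a) ⊎ Away (seq b) →
              Away (λ k → seq a k ℚ.* seq a k ℚ.+ seq b k ℚ.* seq b k)
  away-norm a b (inj₁ away-a) = away-squares (seq a) (seq b) away-a
  away-norm a b (inj₂ away-b) =
    away-resp (λ k → ℚ.+-comm (seq b k ℚ.* seq b k) (seq a k ℚ.* seq a k))
      (away-squares (seq b) (seq a) away-b)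

  norm-#0 : ∀ z → z # 0# → re (conj z ComplexField.* z) #ᵣ 0ᵣ
  norm-#0 z@(a +i b) z#0 = away⇒#0 (re (conj z ComplexField.* z))
    (away-resp (λ k → Identity.norm (seq a k) (seq b k))
      (away-norm a b (Sum.map (#0⇒away a) (#0⇒away b) z#0)))

  -ᵣ-distrib-+ᵣ : ∀ x y → -ᵣ (x +ᵣ y) ≈ᵣ (-ᵣ x) +ᵣ (-ᵣ y)
  -ᵣ-distrib-+ᵣ x y = pointwise (λ k → ℚ.neg-distrib-+ (seq x k) (seq y k))

  -ᵣ-involutive : ∀ x → -ᵣ (-ᵣ x) ≈ᵣ x
  -ᵣ-involutive x = pointwise (λ k → Identity.neg-involutive (seq x k))

  -ᵣ0ᵣ≈0ᵣ : -ᵣ 0ᵣ ≈ᵣ 0ᵣ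
  -ᵣ0ᵣ≈0ᵣ = pointwise (λ _ → ≡.refl)

  conj-* : ∀ z w → conj (z ComplexField.* w) ≈ conj z ComplexField.* conj w
  conj-* (a +i b) (c +i d) =
    pointwise (λ k → Identity.conj-*-re (seq a k) (seq b k) (seq c k) (seq d k)) ,
    pointwise (λ k → Identity.conj-*-im (seq a k) (seq b k) (seq c k) (seq d k))

-- Cotransitivity at `y` leaves two cases, and irreflexivity excludes `x #ᵣ y`.
#ᵣ-congʳ : ∀ {x y z} → x ≈ᵣ y → x #ᵣ z → y #ᵣ z
#ᵣ-congʳ {y = y} x≈y x#z with #ᵣ-cotrans x#z y
... | inj₁ x#y = contradiction x#y (#ᵣ-irrefl x≈y)
... | inj₂ y#z = y#z

⟨,⟩-nonNeg : ∀ {n} (x : Vec n) → NonNegative (re ⟨ x , x ⟩)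
⟨,⟩-nonNeg {zero}  x = 0ᵣ-nonNeg
⟨,⟩-nonNeg {suc n} x =
  +ᵣ-nonNeg _ (re ⟨ tail x , tail x ⟩) (norm-nonNeg (x zero)) (⟨,⟩-nonNeg (tail x))

-- The positive form of definiteness: one squared modulus apart from zero keeps the whole
-- nonnegative sum apart from zero.
re-⟨,⟩-#0 : ∀ {n} (x : Vec n) i → x i # 0# → re ⟨ x , x ⟩ #ᵣ 0ᵣ
re-⟨,⟩-#0 x zero x#0 = +ᵣ-#0ˡ _ (re ⟨ tail x , tail x ⟩)
  (norm-nonNeg (x zero)) (⟨,⟩-nonNeg (tail x)) (norm-#0 (x zero) x#0)
re-⟨,⟩-#0 x (suc i) x#0 = #ᵣ-congʳ
  (+ᵣ-comm (re ⟨ tail x , tail x ⟩) (re (conj (x zero) ComplexField.* x zero)))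
  (+ᵣ-#0ˡ (re ⟨ tail x , tail x ⟩) _
    (⟨,⟩-nonNeg (tail x)) (norm-nonNeg (x zero)) (re-⟨,⟩-#0 (tail x) i x#0))

ℂ-isConjugation : IsConjugation ℂ conj
ℂ-isConjugation = record
  { conj-cong       = λ { (p , q) → p , -ᵣ-cong q }
  ; conj-0#         = ≈ᵣ-refl , -ᵣ0ᵣ≈0ᵣ
  ; conj-+          = λ { (a +i b) (c +i d) → ≈ᵣ-refl , -ᵣ-distrib-+ᵣ b d }
  ; conj-*          = conj-*
  ; conj-involutive = λ { (a +i b) → ≈ᵣ-refl , -ᵣ-involutive b }
  -- Tightness reduces equality with `0#` to refuting apartness, which would make the vanishing norm
  -- apart from zero.
  ; definite        = λ x ⟨x,x⟩≈0 i → proj₁ (HeytingField.tight ℂ (x i) 0#)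
      λ x#0 → #ᵣ-irrefl (proj₁ ⟨x,x⟩≈0) (re-⟨,⟩-#0 x i x#0)
  }

conj-indicator : ∀ {m n} (R : Fin m → Fin n → Bool) → (indicator R) ᴴ ≈ᴹ (indicator R) ᵀ
conj-indicator R i j with R j i
... | true  = ≈ᵣ-refl , -ᵣ0ᵣ≈0ᵣ
... | false = ≈ᵣ-refl , -ᵣ0ᵣ≈0ᵣ

-- Symmetric association schemes and equitable partitions.

open AssociationScheme using (A; IsSymmetric)
open Partition using () renaming (characteristicMatrix to H)

adjacencyMatrix-real : ∀ {v d} (𝒜 : AssociationScheme v d) i → (A 𝒜 i) ᴴ ≈ᴹ (A 𝒜 i) ᵀ
adjacencyMatrix-real 𝒜 i = conj-indicator (AssociationScheme.R 𝒜 i)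

characteristicMatrix-real : ∀ {v t} (π : Partition v t) → (H π) ᴴ ≈ᴹ (H π) ᵀ
characteristicMatrix-real π = conj-indicator (λ x k → does (Partition.cell π x Fin.≟ k))

theorem2 : ∀ {v d t : ℕ} (𝒜 : AssociationScheme v d) → IsSymmetric 𝒜 →
    (W : Fin (suc d) → Pred (Vec v) 0ℓ) → AreTheMaximalCommonEigenspaces (A 𝒜) W →
    (E : Fin (suc d) → Matrix v v) → (∀ j → IsOrthogonalProjection (W j) (E j)) →
    (P : Fin (suc d) → Fin (suc d) → Carrier) → (∀ j i → ActsAs (P j i) (A 𝒜 i) (W j)) →
    (π : Partition v t) → IsEquitable 𝒜 π →
    (N : Fin (suc d) → Matrix t t) → (∀ i → A 𝒜 i *ᴹ H π ≈ᴹ H π *ᴹ N i) →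
    (F : Matrix v v) → IsOrthogonalProjection (columnSpace (H π)) F →
    ∀ j → ∃[ m ] HasDimension (rowImage (W j) (H π)) m ×
                 (∀ i {u} → u ∈ rowImage (W j) (H π) → u ᵛ* N i ≋ P j i ·ᵛ u) ×
                 ⟪ F , E j ⟫ ≈ fromℕ m
theorem2 𝒜 symmetric W maximal E isProjectionE P acts π _ N AH≈HN F isProjectionF j =
  -- The witness for `m` is the rank of the idempotent `F *ᴹ E j`.
  rank , (rowImageBasis , rowImageBasis-isBasis) , ᵛ*-eigenvector , inner-product
  where
  open InnerProductSpace.InvariantColumnSpace ℂ-isConjugation
    symmetric (adjacencyMatrix-real 𝒜)
    (AreTheMaximalCommonEigenspaces.isMaximal maximal j) (isProjectionE j)
    (P j) (acts j) (H π) (characteristicMatrix-real π) N AH≈HN isProjectionF
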